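{- Let $f=a_0+a_1 z+\cdots+a_mz^m\in \mathbb{Z}[z]$ be primitive (the greatest common divisor of its coefficients is $1$). Suppose there exist positive real numbers $\alpha<\beta$ and an index $j\in\{0,1,\ldots,m\}$ such that \[ |a_j|\alpha^j >\left(\frac{\beta}{\alpha}\right)^{m-j}\sum_{i=0,\, i\neq j}^m |a_i|\alpha^i. \] Further, suppose there exist natural numbers $n$, $d$, $k$, $\ell\leq m$, and a prime $p$ with $p\nmid d$ such that $\beta-d\geq n\geq \alpha+d$, $f(n)=\pm p^k d$, $\gcd(k,\ell)=1$, $p^k$ divides $\frac{f^{(i)}(n)}{i!}$ for each $i=0, 1, \ldots,\ell-1$, and, in case $k>1$, also $p\nmid \frac{f^{(\ell)}(n)}{\ell!}$. Then $f$ is irreducible in $\mathbb{Z}[z]$.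
   Context: $f^{(i)}$ denotes the $i$-th derivative of $f$ with respect to $z$. Natural numbers are positive integers. -}

module Defs where

open import Algebra.Bundles.Raw using (RawSemiring)
open import Algebra.Definitions.RawSemiring as RawSemiringDefs using ()
open import Data.Integer.Base as ℤ using (ℤ; +_; 0ℤ; 1ℤ)
import Data.Integer.GCD as ℤ
open import Data.List.Base using (List; []; _∷_; map; foldr)
open import Data.Nat.Base as ℕ using (ℕ; zero; suc; _!)
open import Data.Nat.Properties as ℕₚ using (_!≢0)
open import Data.Product.Base using (∃; _×_; _,_; proj₁; proj₂)
open import Data.Rational.Base as ℚ using (ℚ; 0ℚ; 1ℚ; ½; _+_; _*_; _-_; -_; 1/_; ∣_∣; _<_; _≤_)
open import Data.Rational.Properties as ℚₚ
open import Data.Rational.Solver using (module +-*-Solver)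
open import Level using (0ℓ)
open import Relation.Binary.PropositionalEquality
open import Relation.Nullary using (¬_; yes; no; contradiction)

-- Coefficient lists, constant term first.  Trailing zeros are allowed,
-- so polynomials are compared by _≈ₚ_ and not by _≡_.
Poly : Set
Poly = List ℤ

coeff : Poly → ℕ → ℤ
coeff []      _       = 0ℤ
coeff (a ∷ f) zero    = a
coeff (a ∷ f) (suc i) = coeff f i

infix 4 _≈ₚ_
_≈ₚ_ : Poly → Poly → Set
f ≈ₚ g = ∀ i → coeff f i ≡ coeff g i

infixl 6 _+ₚ_
_+ₚ_ : Poly → Poly → Poly
[]      +ₚ g       = g
(a ∷ f) +ₚ []      = a ∷ f
(a ∷ f) +ₚ (b ∷ g) = (a ℤ.+ b) ∷ (f +ₚ g)

infixl 7 _*ₚ_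
_*ₚ_ : Poly → Poly → Poly
[]      *ₚ g = []
(a ∷ f) *ₚ g = map (a ℤ.*_) g +ₚ (0ℤ ∷ f *ₚ g)

ℤ[z] : RawSemiring 0ℓ 0ℓ
ℤ[z] = record
  { Carrier = Poly
  ; _≈_     = _≈ₚ_
  ; _+_     = _+ₚ_
  ; _*_     = _*ₚ_
  ; 0#      = []
  ; 1#      = 1ℤ ∷ []
  }

-- The library's Irreducible has no explicit f ≉ 0 clause: 0 is excluded by
-- the factorisation 0 = 0 · 0.
open RawSemiringDefs ℤ[z] public using (Irreducible)

Primitive : Poly → Set
Primitive f = foldr ℤ.gcd 0ℤ f ≡ 1ℤ

eval : Poly → ℤ → ℤ
eval []      x = 0ℤ
eval (a ∷ f) x = a ℤ.+ x ℤ.* eval f x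

-- (a + z f)′ = f + z f′
derivative : Poly → Poly
derivative []      = []
derivative (a ∷ f) = f +ₚ (0ℤ ∷ derivative f)

infixl 8 _⁽_⁾
_⁽_⁾ : Poly → ℕ → Poly
f ⁽ zero ⁾  = f
f ⁽ suc i ⁾ = derivative f ⁽ i ⁾

-- f⁽ⁱ⁾(x) / i!.  The integer division is exact, since i! divides every
-- coefficient of the i-th derivative of an integer polynomial.
dividedDerivative : Poly → ℕ → ℤ → ℤ
dividedDerivative f i x = (eval (f ⁽ i ⁾) x ℤ./ℕ (i !)) {{i !≢0}}

-- Cauchy sequences of rationals (with a modulus, by the constructive
-- reading of ∃); all operations are pointwise.
record ℝ : Set where
  constructor mkℝ
  field
    seq    : ℕ → ℚ
    cauchy : ∀ ε → 0ℚ < ε →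
             ∃ λ N → ∀ m n → N ℕ.≤ m → N ℕ.≤ n → ∣ seq m - seq n ∣ < ε

open ℝ public

infix 4 _<ᴿ_ _≤ᴿ_ _≃ᴿ_
_<ᴿ_ : ℝ → ℝ → Set
x <ᴿ y = ∃ λ ε → 0ℚ < ε × ∃ λ N → ∀ n → N ℕ.≤ n → seq x n + ε < seq y n

_≤ᴿ_ : ℝ → ℝ → Set
x ≤ᴿ y = ¬ (y <ᴿ x)

_≃ᴿ_ : ℝ → ℝ → Set
x ≃ᴿ y = x ≤ᴿ y × y ≤ᴿ x

private
  half-pos : ∀ {ε} → 0ℚ < ε → 0ℚ < ½ * ε
  half-pos {ε} 0<ε = subst (_< ½ * ε) (*-zeroʳ ½) (*-monoʳ-<-pos ½ 0<ε)

  halves : ∀ ε → ½ * ε + ½ * ε ≡ ε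
  halves ε = trans (sym (*-distribʳ-+ ε ½ ½)) (*-identityˡ ε)

  *-pos : ∀ {p q} → 0ℚ < p → 0ℚ < q → 0ℚ < p * q
  *-pos {p} {q} 0<p 0<q = subst (_< p * q) (*-zeroʳ p)
    (*-monoʳ-<-pos p {{ℚ.positive 0<p}} 0<q)

-- 1/p, totalised by 1/0 = 0.
inv : ℚ → ℚ
inv p with p ≟ 0ℚ
... | yes _   = 0ℚ
... | no  p≢0 = (1/ p) {{ℚ.≢-nonZero p≢0}}

inv-pos : ∀ {p} → 0ℚ < p → 0ℚ < inv p
inv-pos {p} 0<p with p ≟ 0ℚ
... | yes p≡0 = contradiction (sym p≡0) (<⇒≢ 0<p)
... | no  _   = positive⁻¹ _ {{1/pos⇒pos p {{ℚ.positive 0<p}}}}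

inv-inverse : ∀ {p} → 0ℚ < p → p * inv p ≡ 1ℚ
inv-inverse {p} 0<p with p ≟ 0ℚ
... | yes p≡0 = contradiction (sym p≡0) (<⇒≢ 0<p)
... | no  p≢0 = *-inverseʳ p {{ℚ.≢-nonZero p≢0}}

private
  mono* : ∀ {p q r s} → 0ℚ ≤ p → 0ℚ ≤ s → p ≤ q → r ≤ s → p * r ≤ q * s
  mono* {p} {q} {r} {s} 0≤p 0≤s p≤q r≤s = ≤-trans
    (*-monoˡ-≤-nonNeg p {{ℚ.nonNegative 0≤p}} r≤s)
    (*-monoʳ-≤-nonNeg s {{ℚ.nonNegative 0≤s}} p≤q)

  bounded : ∀ x → ∃ λ B → 0ℚ < B × ∃ λ N → ∀ n → N ℕ.≤ n → ∣ seq x n ∣ < B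
  bounded x with cauchy x 1ℚ (positive⁻¹ 1ℚ)
  ... | N , close = 1ℚ + ∣ seq x N ∣ , <-≤-trans (positive⁻¹ 1ℚ) 1≤B , N , below
    where
    1≤B : 1ℚ ≤ 1ℚ + ∣ seq x N ∣
    1≤B = subst (_≤ 1ℚ + ∣ seq x N ∣) (+-identityʳ 1ℚ) (+-monoʳ-≤ 1ℚ (0≤∣p∣ (seq x N)))
    split : ∀ p q → p ≡ (p - q) + q
    split = +-*-Solver.solve 2 (λ p q → p := (p :- q) :+ q) refl
      where open +-*-Solver
    below : ∀ n → N ℕ.≤ n → ∣ seq x n ∣ < 1ℚ + ∣ seq x N ∣
    below n N≤n = ≤-<-trans
      (subst (λ t → ∣ t ∣ ≤ ∣ seq x n - seq x N ∣ + ∣ seq x N ∣) (sym (split (seq x n) (seq x N)))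
        (∣p+q∣≤∣p∣+∣q∣ (seq x n - seq x N) (seq x N)))
      (+-monoˡ-< ∣ seq x N ∣ (close n N N≤n ℕₚ.≤-refl))

fromℚ : ℚ → ℝ
fromℚ q = mkℝ (λ _ → q) λ ε 0<ε →
  0 , λ _ _ _ _ → subst (_< ε) (sym (cong ∣_∣ (+-inverseʳ q))) 0<ε

fromℕ : ℕ → ℝ
fromℕ n = fromℚ (+ n ℚ./ 1)

0ᴿ 1ᴿ : ℝ
0ᴿ = fromℕ 0
1ᴿ = fromℕ 1

infixl 6 _+ᴿ_ _-ᴿ_
infixl 7 _*ᴿ_

_+ᴿ_ : ℝ → ℝ → ℝ
x +ᴿ y = mkℝ (λ n → seq x n + seq y n) proof
  where
  regroup : ∀ a b c d → (a + b) - (c + d) ≡ (a - c) + (b - d)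
  regroup = +-*-Solver.solve 4 (λ a b c d → (a :+ b) :- (c :+ d) := (a :- c) :+ (b :- d)) refl
    where open +-*-Solver
  proof : ∀ ε → 0ℚ < ε → ∃ λ N → ∀ m n → N ℕ.≤ m → N ℕ.≤ n →
          ∣ (seq x m + seq y m) - (seq x n + seq y n) ∣ < ε
  proof ε 0<ε with cauchy x (½ * ε) (half-pos 0<ε) | cauchy y (½ * ε) (half-pos 0<ε)
  ... | M , closeˣ | N , closeʸ = M ℕ.⊔ N , λ m n m≥ n≥ →
    subst₂ _<_ (cong ∣_∣ (sym (regroup (seq x m) (seq y m) (seq x n) (seq y n)))) (halves ε)
      (≤-<-trans (∣p+q∣≤∣p∣+∣q∣ (seq x m - seq x n) (seq y m - seq y n))
        (+-mono-< (closeˣ m n (ℕₚ.m⊔n≤o⇒m≤o M N m≥) (ℕₚ.m⊔n≤o⇒m≤o M N n≥))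
                  (closeʸ m n (ℕₚ.m⊔n≤o⇒n≤o M N m≥) (ℕₚ.m⊔n≤o⇒n≤o M N n≥))))

-ᴿ_ : ℝ → ℝ
-ᴿ x = mkℝ (λ n → - seq x n) proof
  where
  regroup : ∀ a b → (- a) - (- b) ≡ - (a - b)
  regroup = +-*-Solver.solve 2 (λ a b → (:- a) :- (:- b) := :- (a :- b)) refl
    where open +-*-Solver
  proof : ∀ ε → 0ℚ < ε → ∃ λ N → ∀ m n → N ℕ.≤ m → N ℕ.≤ n → ∣ (- seq x m) - (- seq x n) ∣ < ε
  proof ε 0<ε with cauchy x ε 0<ε
  ... | N , close = N , λ m n m≥ n≥ →
    subst (_< ε)
      (sym (trans (cong ∣_∣ (regroup (seq x m) (seq x n))) (∣-p∣≡∣p∣ (seq x m - seq x n))))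
      (close m n m≥ n≥)

_-ᴿ_ : ℝ → ℝ → ℝ
x -ᴿ y = x +ᴿ (-ᴿ y)

_*ᴿ_ : ℝ → ℝ → ℝ
x *ᴿ y = mkℝ (λ n → seq x n * seq y n) proof
  where
  regroup : ∀ a b c d → a * b - c * d ≡ a * (b - d) + d * (a - c)
  regroup = +-*-Solver.solve 4 (λ a b c d → a :* b :- c :* d := a :* (b :- d) :+ d :* (a :- c)) refl
    where open +-*-Solver
  scaled : ∀ {ε B} → 0ℚ < B → B * (½ * ε * inv B) ≡ ½ * ε
  scaled {ε} {B} 0<B = begin
    B * (½ * ε * inv B)   ≡⟨ *-comm B (½ * ε * inv B) ⟩
    ½ * ε * inv B * B     ≡⟨ *-assoc (½ * ε) (inv B) B ⟩
    ½ * ε * (inv B * B)   ≡⟨ cong (½ * ε *_) (trans (*-comm (inv B) B) (inv-inverse 0<B)) ⟩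
    ½ * ε * 1ℚ            ≡⟨ *-identityʳ (½ * ε) ⟩
    ½ * ε                 ∎
    where open ≡-Reasoning
  small : ∀ {ε B p q} → 0ℚ < B → ∣ p ∣ < B → ∣ q ∣ < ½ * ε * inv B → ∣ p * q ∣ < ½ * ε
  small {ε} {B} {p} {q} 0<B p<B q<δ = subst₂ _<_ (sym (∣p*q∣≡∣p∣*∣q∣ p q)) (scaled {ε} 0<B)
    (≤-<-trans (*-monoʳ-≤-nonNeg ∣ q ∣ {{ℚ.nonNegative (0≤∣p∣ q)}} (<⇒≤ p<B))
      (*-monoʳ-<-pos B {{ℚ.positive 0<B}} q<δ))
  Bound : ℝ → Set
  Bound z = ∃ λ B → 0ℚ < B × ∃ λ N → ∀ n → N ℕ.≤ n → ∣ seq z n ∣ < B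

  Close : ℝ → ℚ → Set
  Close z δ = ∃ λ N → ∀ m n → N ℕ.≤ m → N ℕ.≤ n → ∣ seq z m - seq z n ∣ < δ

  combine : ∀ {ε B C} a b c d → 0ℚ < B → 0ℚ < C → ∣ a ∣ < B → ∣ d ∣ < C →
            ∣ b - d ∣ < ½ * ε * inv B → ∣ a - c ∣ < ½ * ε * inv C →
            ∣ a * b - c * d ∣ < ε
  combine {ε} {B} {C} a b c d 0<B 0<C a<B d<C b-d a-c = begin-strict
    ∣ a * b - c * d ∣                   ≡⟨ cong ∣_∣ (regroup a b c d) ⟩
    ∣ a * (b - d) + d * (a - c) ∣       ≤⟨ ∣p+q∣≤∣p∣+∣q∣ (a * (b - d)) (d * (a - c)) ⟩
    ∣ a * (b - d) ∣ + ∣ d * (a - c) ∣   <⟨ +-mono-< (small {ε} {B} {a} {b - d} 0<B a<B b-d)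
                                                    (small {ε} {C} {d} {a - c} 0<C d<C a-c) ⟩
    ½ * ε + ½ * ε                       ≡⟨ halves ε ⟩
    ε                                   ∎
    where open ≤-Reasoning

  close : ∀ {ε} ((B , _) : Bound x) ((C , _) : Bound y) →
          Close x (½ * ε * inv C) → Close y (½ * ε * inv B) →
          ∃ λ N → ∀ m n → N ℕ.≤ m → N ℕ.≤ n → ∣ seq x m * seq y m - seq x n * seq y n ∣ < ε
  close {ε} (B , 0<B , N₁ , x<B) (C , 0<C , N₂ , y<C) (N₃ , closeˣ) (N₄ , closeʸ) =
    (N₁ ℕ.⊔ N₂) ℕ.⊔ (N₃ ℕ.⊔ N₄) , λ m n m≥ n≥ →
    combine {ε} {B} {C} (seq x m) (seq y m) (seq x n) (seq y n) 0<B 0<C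
      (x<B m (ℕₚ.m⊔n≤o⇒m≤o N₁ N₂ (fst m≥)))
      (y<C n (ℕₚ.m⊔n≤o⇒n≤o N₁ N₂ (fst n≥)))
      (closeʸ m n (ℕₚ.m⊔n≤o⇒n≤o N₃ N₄ (snd m≥)) (ℕₚ.m⊔n≤o⇒n≤o N₃ N₄ (snd n≥)))
      (closeˣ m n (ℕₚ.m⊔n≤o⇒m≤o N₃ N₄ (snd m≥)) (ℕₚ.m⊔n≤o⇒m≤o N₃ N₄ (snd n≥)))
    where
    fst : ∀ {m} → (N₁ ℕ.⊔ N₂) ℕ.⊔ (N₃ ℕ.⊔ N₄) ℕ.≤ m → N₁ ℕ.⊔ N₂ ℕ.≤ m
    fst = ℕₚ.m⊔n≤o⇒m≤o (N₁ ℕ.⊔ N₂) (N₃ ℕ.⊔ N₄)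
    snd : ∀ {m} → (N₁ ℕ.⊔ N₂) ℕ.⊔ (N₃ ℕ.⊔ N₄) ℕ.≤ m → N₃ ℕ.⊔ N₄ ℕ.≤ m
    snd = ℕₚ.m⊔n≤o⇒n≤o (N₁ ℕ.⊔ N₂) (N₃ ℕ.⊔ N₄)

  proof : ∀ ε → 0ℚ < ε → ∃ λ N → ∀ m n → N ℕ.≤ m → N ℕ.≤ n →
          ∣ seq x m * seq y m - seq x n * seq y n ∣ < ε
  proof ε 0<ε = close {ε} Bx By
    (cauchy x _ (*-pos (half-pos 0<ε) (inv-pos (proj₁ (proj₂ By)))))
    (cauchy y _ (*-pos (half-pos 0<ε) (inv-pos (proj₁ (proj₂ Bx)))))
    where
    Bx : Bound x
    Bx = bounded x
    By : Bound y
    By = bounded y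

-- Reciprocal of a positive real.  The finitely many terms that may
-- vanish do not affect the limit.
infix 8 _⁻¹[_]
_⁻¹[_] : (x : ℝ) → 0ᴿ <ᴿ x → ℝ
x ⁻¹[ η , 0<η , M , η<x ] = mkℝ (λ n → inv (seq x n)) proof
  where
  η<xₙ : ∀ {n} → M ℕ.≤ n → η < seq x n
  η<xₙ {n} n≥ = subst (_< seq x n) (+-identityˡ η) (η<x n n≥)

  regroup : ∀ {a b} → 0ℚ < a → 0ℚ < b → inv a - inv b ≡ (b - a) * (inv a * inv b)
  regroup {a} {b} 0<a 0<b = begin
    inv a - inv b
      ≡⟨ cong₂ _-_ (sym (*-identityʳ (inv a))) (sym (*-identityʳ (inv b))) ⟩
    inv a * 1ℚ - inv b * 1ℚ
      ≡⟨ cong₂ (λ s t → inv a * s - inv b * t) (sym (inv-inverse 0<b)) (sym (inv-inverse 0<a)) ⟩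
    inv a * (b * inv b) - inv b * (a * inv a)
      ≡⟨ solve 4 (λ a b i j → i :* (b :* j) :- j :* (a :* i) := (b :- a) :* (i :* j)) refl a b (inv a) (inv b) ⟩
    (b - a) * (inv a * inv b) ∎
    where
    open ≡-Reasoning
    open +-*-Solver

  η*inv≤1 : ∀ {a} → η < a → η * inv a ≤ 1ℚ
  η*inv≤1 {a} η<a = subst (η * inv a ≤_) (inv-inverse (<-trans 0<η η<a))
    (*-monoʳ-≤-nonNeg (inv a) {{ℚ.nonNegative (<⇒≤ (inv-pos (<-trans 0<η η<a)))}} (<⇒≤ η<a))

  small : ∀ {ε a b} → 0ℚ < ε → η < a → η < b → ∣ b - a ∣ < ε * (η * η) → ∣ inv a - inv b ∣ < ε
  small {ε} {a} {b} 0<ε η<a η<b close = begin-strict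
    ∣ inv a - inv b ∣                 ≡⟨ cong ∣_∣ (regroup 0<a 0<b) ⟩
    ∣ (b - a) * (inv a * inv b) ∣     ≡⟨ ∣p*q∣≡∣p∣*∣q∣ (b - a) (inv a * inv b) ⟩
    ∣ b - a ∣ * ∣ inv a * inv b ∣     ≡⟨ cong (∣ b - a ∣ *_) (0≤p⇒∣p∣≡p (<⇒≤ 0<ij)) ⟩
    ∣ b - a ∣ * (inv a * inv b)       <⟨ *-monoˡ-<-pos (inv a * inv b) {{ℚ.positive 0<ij}} close ⟩
    ε * (η * η) * (inv a * inv b)     ≡⟨ solve 4 (λ e h i j → e :* (h :* h) :* (i :* j) := e :* ((h :* i) :* (h :* j))) refl ε η (inv a) (inv b) ⟩
    ε * ((η * inv a) * (η * inv b))   ≤⟨ *-monoˡ-≤-nonNeg ε {{ℚ.nonNegative (<⇒≤ 0<ε)}}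
                                           (mono* (<⇒≤ (*-pos 0<η (inv-pos 0<a))) (<⇒≤ (positive⁻¹ 1ℚ))
                                             (η*inv≤1 η<a) (η*inv≤1 η<b)) ⟩
    ε * (1ℚ * 1ℚ)                     ≡⟨ *-identityʳ ε ⟩
    ε                                 ∎
    where
    open ≤-Reasoning
    open +-*-Solver using (solve; _:*_; _:=_)
    0<a : 0ℚ < a
    0<a = <-trans 0<η η<a
    0<b : 0ℚ < b
    0<b = <-trans 0<η η<b
    0<ij : 0ℚ < inv a * inv b
    0<ij = *-pos (inv-pos 0<a) (inv-pos 0<b)

  proof : ∀ ε → 0ℚ < ε → ∃ λ N → ∀ m n → N ℕ.≤ m → N ℕ.≤ n →
          ∣ inv (seq x m) - inv (seq x n) ∣ < ε
  proof ε 0<ε with cauchy x (ε * (η * η)) (*-pos 0<ε (*-pos 0<η 0<η))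
  ... | N , close = M ℕ.⊔ N , λ m n m≥ n≥ →
    small {ε} {seq x m} {seq x n} 0<ε
      (η<xₙ (ℕₚ.m⊔n≤o⇒m≤o M N m≥)) (η<xₙ (ℕₚ.m⊔n≤o⇒m≤o M N n≥))
      (close n m (ℕₚ.m⊔n≤o⇒n≤o M N n≥) (ℕₚ.m⊔n≤o⇒n≤o M N m≥))

ℝ-rawSemiring : RawSemiring 0ℓ 0ℓ
ℝ-rawSemiring = record
  { Carrier = ℝ
  ; _≈_     = _≃ᴿ_
  ; _+_     = _+ᴿ_
  ; _*_     = _*ᴿ_
  ; 0#      = 0ᴿ
  ; 1#      = 1ᴿ
  }

open RawSemiringDefs ℝ-rawSemiring public using () renaming (_^_ to _^ᴿ_; sum to sumᴿ)

{-# OPTIONS --safe #-}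
module Submission where

open import Defs
open import Algebra.Bundles using (CommutativeRing)
import Algebra.Definitions.RawMonoid
import Algebra.Definitions.RawSemiring
import Algebra.Properties.CommutativeSemiring.Exp as Exp
open import Data.Empty using (⊥)
open import Data.Fin.Base using (Fin; zero; suc; toℕ; punchIn)
open import Data.Fin.Properties using (toℕ≤pred[n])
open import Data.Integer.Base as ℤ using (ℤ; +_; -_; -[1+_]; ∣_∣; 0ℤ; 1ℤ)
import Data.Integer.DivMod as ℤ
open import Data.Integer.Divisibility using (_∣_)
import Data.Integer.Divisibility.Signed as Signed
import Data.Integer.GCD as ℤ
import Data.Integer.Properties as ℤₚ
open import Data.Integer.Tactic.RingSolver using (solve-∀)
open import Data.List.Base using (List; []; _∷_; map; length; foldr)
open import Data.Nat.Base as ℕ using (ℕ; zero; suc; _+_; _*_; _∸_; _^_; _≤_; _<_; _⊓_; z≤n; s≤s; _!)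
import Data.Nat.Coprimality as Coprime
open import Data.Nat.Divisibility as ℕ∣ using () renaming (_∣_ to _∣ℕ_; _∤_ to _∤ℕ_)
open import Data.Nat.GCD using (gcd)
open import Data.Nat.Primality using (Prime; euclidsLemma; prime⇒nonZero; prime⇒nonTrivial)
import Data.Nat.Properties as ℕₚ
import Data.Nat.Tactic.RingSolver as ℕ-Solver
open import Data.Product.Base using (∃; ∃₂; _×_; _,_; proj₁; proj₂)
open import Data.Rational.Base as ℚ using (ℚ; 0ℚ; 1ℚ; ½; mkℚ)
import Data.Rational.Properties as ℚₚ
open import Data.Rational.Solver using (module +-*-Solver)
open import Data.Sum.Base using (_⊎_; inj₁; inj₂; [_,_]′)
open import Data.Vec.Base using (Vec; []; _∷_; lookup; toList)
open import Data.Vec.Functional using (Vector; removeAt)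
open import Relation.Binary.PropositionalEquality using (_≡_; _≢_; _≗_; refl; sym; trans; cong; cong₂; subst; subst₂; module ≡-Reasoning)
open import Relation.Nullary using (¬_; Dec; yes; no; contradiction)
open import Relation.Nullary.Decidable using (_×-dec_; map′)
open import Relation.Unary using (Decidable)

open Algebra.Definitions.RawMonoid ℕ.+-0-rawMonoid using (sum)
open Algebra.Definitions.RawMonoid ℚ.+-0-rawMonoid using () renaming (sum to sumℚ)
open Algebra.Definitions.RawSemiring ℤ[z] using () renaming (_∣_ to _∣ₚ_)
open Exp (CommutativeRing.commutativeSemiring ℚₚ.+-*-commutativeRing) using (^-homo-*; ^-distrib-*) renaming (_^_ to _^ℚ_)
open +-*-Solver using (solve; _:=_; _:+_; _:*_; _:-_; con)

-- No complex roots are used.  Put A = n - d and B = n + d.  The hypothesis on α and β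
-- gives the integral inequality  Σ_{i≠j} |aᵢ| A^(i ⊓ j) B^(i ∸ j) < |aⱼ| A^j,  and this makes
-- f (n + c w) invertible in the ℓ¹ algebra of power series in w whenever |c| ≤ d: there
-- n + c w has norm at most B and its inverse has norm at most 1 / A.
--
-- Let f = g h with g nonconstant and c = g (n).  Then g (n + c w) = c (1 + …) has an inverse
-- Q / c with Q integral.  If |c| ≤ d, then Q = c h (n + c w) / f (n + c w) is summable, so it
-- is a polynomial and g is constant.  Hence |g (n)| > d and |h (n)| > d, and p divides both.
--
-- Now consider g and h in powers of z - n.  The p-adic Newton polygon of f has the edge
-- from (0 , k) to (ℓ , 0), which has no interior lattice point as gcd (k , ℓ) = 1; it lies in
-- the polygon of one factor, so the value of the other factor at n is prime to p.

-- Over the complex numbers the hypothesis keeps every root of `f` at distance more than `d` from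
-- `n`, and `g (n)` is a leading coefficient times such distances. Integrality replaces the roots
-- here: with `c = g (n)` itself as the scale of `w`, the series `g (n + c w)` is divisible by `c`,
-- and a series of integers with bounded partial norms has only finitely many nonzero terms. All
-- norms are truncated; multiplication by `n + c w` never looks at later coefficients, so every
-- bound survives truncation.
--
-- The weights A^(i ⊓ j) B^(i ∸ j) come from comparing (n + c w)^i S with (n + c w)^j S: one power
-- up costs at most a factor B, one power down gains a factor 1 / A, and A^j clears the
-- denominators.
--
-- For Cauchy reals `≤ᴿ` yields inequalities between terms only up to an error, so α and β cannot
-- simply be replaced by A and B. But the integral inequality is decidable: its negation is refuted
-- at one index of the sequences, where the strict gap in the hypothesis absorbs all errors.

-- Polynomials acting on power series

Seq : Set
Seq = ℕ → ℤ

δ : Seq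
δ zero    = 1ℤ
δ (suc _) = 0ℤ

-- Sequences are power series in w; op n c is multiplication by n + c w and
-- act n c f multiplication by f (n + c w).
op : ℤ → ℤ → Seq → Seq
op n c S zero    = n ℤ.* S zero
op n c S (suc i) = n ℤ.* S (suc i) ℤ.+ c ℤ.* S i

act : ℤ → ℤ → Poly → Seq → Seq
act n c []      S i = 0ℤ
act n c (a ∷ f) S i = a ℤ.* S i ℤ.+ op n c (act n c f S) i

module _ (n c : ℤ) where

  op-cong : ∀ {S R} → S ≗ R → op n c S ≗ op n c R
  op-cong e zero    = cong (n ℤ.*_) (e zero)
  op-cong e (suc i) = cong₂ (λ x y → n ℤ.* x ℤ.+ c ℤ.* y) (e (suc i)) (e i)

  op-+ : ∀ S R i → op n c (λ i → S i ℤ.+ R i) i ≡ op n c S i ℤ.+ op n c R i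
  op-+ S R zero    = ℤₚ.*-distribˡ-+ n (S zero) (R zero)
  op-+ S R (suc i) = ring n c (S (suc i)) (R (suc i)) (S i) (R i)
    where
    ring : ∀ n c s r t u →
           n ℤ.* (s ℤ.+ r) ℤ.+ c ℤ.* (t ℤ.+ u) ≡ n ℤ.* s ℤ.+ c ℤ.* t ℤ.+ (n ℤ.* r ℤ.+ c ℤ.* u)
    ring = solve-∀

  op-* : ∀ a S i → op n c (λ i → a ℤ.* S i) i ≡ a ℤ.* op n c S i
  op-* a S zero    = ring n a (S zero)
    where
    ring : ∀ n a s → n ℤ.* (a ℤ.* s) ≡ a ℤ.* (n ℤ.* s)
    ring = solve-∀
  op-* a S (suc i) = ring n c a (S (suc i)) (S i)
    where
    ring : ∀ n c a s t → n ℤ.* (a ℤ.* s) ℤ.+ c ℤ.* (a ℤ.* t) ≡ a ℤ.* (n ℤ.* s ℤ.+ c ℤ.* t)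
    ring = solve-∀

  op-0 : ∀ {S} → (∀ i → S i ≡ 0ℤ) → ∀ i → op n c S i ≡ 0ℤ
  op-0 {S} e i = trans (op-cong {S} {λ i → 0ℤ ℤ.* S i} e i) (op-* 0ℤ S i)

  act-cong : ∀ f {S R} → S ≗ R → act n c f S ≗ act n c f R
  act-cong []      e i = refl
  act-cong (a ∷ f) e i = cong₂ ℤ._+_ (cong (a ℤ.*_) (e i)) (op-cong (act-cong f e) i)

  act-+ : ∀ f S R i → act n c f (λ i → S i ℤ.+ R i) i ≡ act n c f S i ℤ.+ act n c f R i
  act-+ []      S R i = refl
  act-+ (a ∷ f) S R i = trans
    (cong (λ x → a ℤ.* (S i ℤ.+ R i) ℤ.+ x) (trans (op-cong (act-+ f S R) i) (op-+ (act n c f S) (act n c f R) i)))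
    (ring a (S i) (R i) _ _)
    where
    ring : ∀ a s r t u → a ℤ.* (s ℤ.+ r) ℤ.+ (t ℤ.+ u) ≡ a ℤ.* s ℤ.+ t ℤ.+ (a ℤ.* r ℤ.+ u)
    ring = solve-∀

  act-* : ∀ f b S i → act n c f (λ i → b ℤ.* S i) i ≡ b ℤ.* act n c f S i
  act-* []      b S i = sym (ℤₚ.*-zeroʳ b)
  act-* (a ∷ f) b S i = trans
    (cong (λ x → a ℤ.* (b ℤ.* S i) ℤ.+ x) (trans (op-cong (act-* f b S) i) (op-* b (act n c f S) i)))
    (ring a b (S i) _)
    where
    ring : ∀ a b s t → a ℤ.* (b ℤ.* s) ℤ.+ b ℤ.* t ≡ b ℤ.* (a ℤ.* s ℤ.+ t)
    ring = solve-∀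

  act-op : ∀ f S → act n c f (op n c S) ≗ op n c (act n c f S)
  act-op []      S i = sym (op-0 (λ _ → refl) i)
  act-op (a ∷ f) S i = sym (trans (op-+ (λ i → a ℤ.* S i) (op n c (act n c f S)) i)
    (cong₂ ℤ._+_ (op-* a S i) (op-cong (λ k → sym (act-op f S k)) i)))

  -- Both actions are integral combinations of powers of the same operator `op n c`.
  act-comm : ∀ f g S → act n c f (act n c g S) ≗ act n c g (act n c f S)
  act-comm []      g S i = sym (trans (act-* g 0ℤ (λ _ → 0ℤ) i) refl)
  act-comm (a ∷ f) g S i = sym (trans (act-+ g (λ i → a ℤ.* S i) (op n c (act n c f S)) i)
    (cong₂ ℤ._+_ (act-* g a S i)
      (trans (act-op g (act n c f S) i) (op-cong (λ k → sym (act-comm f g S k)) i))))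

  act-≈0 : ∀ f S → (∀ i → coeff f i ≡ 0ℤ) → ∀ i → act n c f S i ≡ 0ℤ
  act-≈0 []      S z i = refl
  act-≈0 (a ∷ f) S z i = cong₂ ℤ._+_ (cong (ℤ._* S i) (z 0)) (op-0 (act-≈0 f S (λ i → z (suc i))) i)

  act-≈ : ∀ f g S → f ≈ₚ g → act n c f S ≗ act n c g S
  act-≈ []      g       S e i = sym (act-≈0 g S (λ i → sym (e i)) i)
  act-≈ (a ∷ f) []      S e i = act-≈0 (a ∷ f) S e i
  act-≈ (a ∷ f) (b ∷ g) S e i = cong₂ ℤ._+_ (cong (ℤ._* S i) (e 0))
    (op-cong (act-≈ f g S (λ i → e (suc i))) i)

  act-+ₚ : ∀ f g S i → act n c (f +ₚ g) S i ≡ act n c f S i ℤ.+ act n c g S i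
  act-+ₚ []      g       S i = sym (ℤₚ.+-identityˡ _)
  act-+ₚ (a ∷ f) []      S i = sym (ℤₚ.+-identityʳ _)
  act-+ₚ (a ∷ f) (b ∷ g) S i = trans
    (cong (λ x → (a ℤ.+ b) ℤ.* S i ℤ.+ x)
      (trans (op-cong (act-+ₚ f g S) i) (op-+ (act n c f S) (act n c g S) i)))
    (ring a b (S i) _ _)
    where
    ring : ∀ a b s t u → (a ℤ.+ b) ℤ.* s ℤ.+ (t ℤ.+ u) ≡ a ℤ.* s ℤ.+ t ℤ.+ (b ℤ.* s ℤ.+ u)
    ring = solve-∀

  act-map : ∀ a g S i → act n c (map (a ℤ.*_) g) S i ≡ a ℤ.* act n c g S i
  act-map a []      S i = sym (ℤₚ.*-zeroʳ a)
  act-map a (b ∷ g) S i = trans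
    (cong (λ x → a ℤ.* b ℤ.* S i ℤ.+ x)
      (trans (op-cong (act-map a g S) i) (op-* a (act n c g S) i)))
    (ring a b (S i) _)
    where
    ring : ∀ a b s t → a ℤ.* b ℤ.* s ℤ.+ a ℤ.* t ≡ a ℤ.* (b ℤ.* s ℤ.+ t)
    ring = solve-∀

  act-0∷ : ∀ f S i → act n c (0ℤ ∷ f) S i ≡ op n c (act n c f S) i
  act-0∷ f S i = ℤₚ.+-identityˡ _

  act-*ₚ : ∀ f g S → act n c (f *ₚ g) S ≗ act n c f (act n c g S)
  act-*ₚ []      g S i = refl
  act-*ₚ (a ∷ f) g S i = trans (act-+ₚ (map (a ℤ.*_) g) (0ℤ ∷ f *ₚ g) S i)
    (cong₂ ℤ._+_ (act-map a g S i) (trans (act-0∷ (f *ₚ g) S i) (op-cong (act-*ₚ f g S) i)))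

  eval-act : ∀ f → eval f n ≡ act n c f δ 0
  eval-act []      = refl
  eval-act (a ∷ f) = cong₂ ℤ._+_ (sym (ℤₚ.*-identityʳ a)) (cong (n ℤ.*_) (eval-act f))

-- At `n` = 0 and `c` = 1 the action is multiplication by `f (w)`, so identities between
-- coefficients, such as commutativity of `*ₚ`, can be read off from identities between operators.
coeff-act : ∀ f i → coeff f i ≡ act 0ℤ 1ℤ f δ i
coeff-act []      i       = refl
coeff-act (a ∷ f) zero    = sym (trans (ℤₚ.+-identityʳ _) (ℤₚ.*-identityʳ a))
coeff-act (a ∷ f) (suc i) = trans (coeff-act f i) (ring a (act 0ℤ 1ℤ f δ (suc i)) (act 0ℤ 1ℤ f δ i))
  where
  ring : ∀ a t s → s ≡ a ℤ.* 0ℤ ℤ.+ (0ℤ ℤ.* t ℤ.+ 1ℤ ℤ.* s)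
  ring = solve-∀

*ₚ-comm : ∀ f g → f *ₚ g ≈ₚ g *ₚ f
*ₚ-comm f g i = begin
  coeff (f *ₚ g) i                       ≡⟨ coeff-act (f *ₚ g) i ⟩
  act 0ℤ 1ℤ (f *ₚ g) δ i                 ≡⟨ act-*ₚ 0ℤ 1ℤ f g δ i ⟩
  act 0ℤ 1ℤ f (act 0ℤ 1ℤ g δ) i          ≡⟨ act-comm 0ℤ 1ℤ f g δ i ⟩
  act 0ℤ 1ℤ g (act 0ℤ 1ℤ f δ) i          ≡⟨ act-*ₚ 0ℤ 1ℤ g f δ i ⟨
  act 0ℤ 1ℤ (g *ₚ f) δ i                 ≡⟨ coeff-act (g *ₚ f) i ⟨
  coeff (g *ₚ f) i                       ∎
  where open ≡-Reasoning

-- Convolution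

infixl 7 _⋆_
_⋆_ : Seq → Seq → Seq
(S ⋆ R) zero    = S zero ℤ.* R zero
(S ⋆ R) (suc k) = S zero ℤ.* R (suc k) ℤ.+ ((λ i → S (suc i)) ⋆ R) k

⋆-congˡ : ∀ {S S′} R → S ≗ S′ → S ⋆ R ≗ S′ ⋆ R
⋆-congˡ R e zero    = cong (ℤ._* R 0) (e 0)
⋆-congˡ R e (suc k) = cong₂ ℤ._+_ (cong (ℤ._* R (suc k)) (e 0)) (⋆-congˡ R (λ i → e (suc i)) k)

⋆-lincomb : ∀ a b S T R k →
            ((λ i → a ℤ.* S i ℤ.+ b ℤ.* T i) ⋆ R) k ≡ a ℤ.* (S ⋆ R) k ℤ.+ b ℤ.* (T ⋆ R) k
⋆-lincomb a b S T R zero    = ring a b (S 0) (T 0) (R 0)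
  where
  ring : ∀ a b s t r → (a ℤ.* s ℤ.+ b ℤ.* t) ℤ.* r ≡ a ℤ.* (s ℤ.* r) ℤ.+ b ℤ.* (t ℤ.* r)
  ring = solve-∀
⋆-lincomb a b S T R (suc k) = trans
  (cong (λ x → (a ℤ.* S 0 ℤ.+ b ℤ.* T 0) ℤ.* R (suc k) ℤ.+ x)
    (⋆-lincomb a b (λ i → S (suc i)) (λ i → T (suc i)) R k))
  (ring a b (S 0) (T 0) (R (suc k)) _ _)
  where
  ring : ∀ a b s t r u v → (a ℤ.* s ℤ.+ b ℤ.* t) ℤ.* r ℤ.+ (a ℤ.* u ℤ.+ b ℤ.* v)
                         ≡ a ℤ.* (s ℤ.* r ℤ.+ u) ℤ.+ b ℤ.* (t ℤ.* r ℤ.+ v)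
  ring = solve-∀

op-⋆ : ∀ n c S R → op n c S ⋆ R ≗ op n c (S ⋆ R)
op-⋆ n c S R zero    = ℤₚ.*-assoc n (S 0) (R 0)
op-⋆ n c S R (suc k) = trans
  (cong (λ x → n ℤ.* S 0 ℤ.* R (suc k) ℤ.+ x) (⋆-lincomb n c (λ i → S (suc i)) S R k))
  (ring n (S 0) (R (suc k)) _ _)
  where
  ring : ∀ n s r t u → n ℤ.* s ℤ.* r ℤ.+ (n ℤ.* t ℤ.+ u) ≡ n ℤ.* (s ℤ.* r ℤ.+ t) ℤ.+ u
  ring = solve-∀

⋆-zeroˡ : ∀ R k → ((λ _ → 0ℤ) ⋆ R) k ≡ 0ℤ
⋆-zeroˡ R zero    = refl
⋆-zeroˡ R (suc k) = trans (ℤₚ.+-identityˡ _) (⋆-zeroˡ R k)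

⋆-identityˡ : ∀ R → δ ⋆ R ≗ R
⋆-identityˡ R zero    = ℤₚ.*-identityˡ (R 0)
⋆-identityˡ R (suc k) = trans (cong₂ ℤ._+_ (ℤₚ.*-identityˡ (R (suc k))) (⋆-zeroˡ R k)) (ℤₚ.+-identityʳ _)

-- `act` is Horner's scheme run on `S`. Pulling `S` out of it turns a factorisation of `f` into a
-- convolution of the expansions of the factors.
act-⋆ : ∀ n c f S → act n c f S ≗ act n c f δ ⋆ S
act-⋆ n c []      S i = sym (⋆-zeroˡ S i)
act-⋆ n c (a ∷ f) S i = begin
  a ℤ.* S i ℤ.+ op n c (act n c f S) i
    ≡⟨ cong₂ ℤ._+_ (cong (a ℤ.*_) (sym (⋆-identityˡ S i)))
         (trans (op-cong n c (act-⋆ n c f S) i) (sym (op-⋆ n c (act n c f δ) S i))) ⟩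
  a ℤ.* (δ ⋆ S) i ℤ.+ (op n c (act n c f δ) ⋆ S) i
    ≡⟨ cong (λ x → a ℤ.* (δ ⋆ S) i ℤ.+ x) (ℤₚ.*-identityˡ _) ⟨
  a ℤ.* (δ ⋆ S) i ℤ.+ 1ℤ ℤ.* (op n c (act n c f δ) ⋆ S) i
    ≡⟨ ⋆-lincomb a 1ℤ δ (op n c (act n c f δ)) S i ⟨
  ((λ k → a ℤ.* δ k ℤ.+ 1ℤ ℤ.* op n c (act n c f δ) k) ⋆ S) i
    ≡⟨ ⋆-congˡ S (λ k → cong (λ x → a ℤ.* δ k ℤ.+ x) (ℤₚ.*-identityˡ _)) i ⟩
  (act n c (a ∷ f) δ ⋆ S) i ∎
  where open ≡-Reasoning

-- Taylor coefficients and divided derivatives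

taylor : Poly → ℤ → Seq
taylor f n = act n 1ℤ f δ

taylor-*ₚ : ∀ f g h n → f ≈ₚ g *ₚ h → taylor f n ≗ taylor g n ⋆ taylor h n
taylor-*ₚ f g h n f≈gh i = trans (act-≈ n 1ℤ f (g *ₚ h) δ f≈gh i)
  (trans (act-*ₚ n 1ℤ g h δ i) (act-⋆ n 1ℤ g (taylor h n) i))

eval-*ₚ : ∀ f g h n → f ≈ₚ g *ₚ h → eval f n ≡ eval g n ℤ.* eval h n
eval-*ₚ f g h n f≈gh = trans (eval-act n 1ℤ f) (trans (taylor-*ₚ f g h n f≈gh 0)
  (sym (cong₂ ℤ._*_ (eval-act n 1ℤ g) (eval-act n 1ℤ h))))

-- The product rule for `a + z f`, where multiplication by `z` appears as `op n 1ℤ`.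
taylor-derivative : ∀ f n i → taylor (derivative f) n i ≡ + suc i ℤ.* taylor f n (suc i)
taylor-derivative []      n i = sym (ℤₚ.*-zeroʳ (+ suc i))
taylor-derivative (a ∷ f) n i = trans (act-+ₚ n 1ℤ f (0ℤ ∷ derivative f) δ i)
  (trans (cong (λ x → taylor f n i ℤ.+ x) (act-0∷ n 1ℤ (derivative f) δ i)) (step i))
  where
  step : ∀ i → taylor f n i ℤ.+ op n 1ℤ (taylor (derivative f) n) i
             ≡ + suc i ℤ.* (a ℤ.* 0ℤ ℤ.+ (n ℤ.* taylor f n (suc i) ℤ.+ 1ℤ ℤ.* taylor f n i))
  step zero = trans (cong (λ x → taylor f n 0 ℤ.+ n ℤ.* x) (taylor-derivative f n 0))
                    (ring n a (taylor f n 0) (taylor f n 1))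
    where
    ring : ∀ n a s t → s ℤ.+ n ℤ.* (+ 1 ℤ.* t) ≡ + 1 ℤ.* (a ℤ.* 0ℤ ℤ.+ (n ℤ.* t ℤ.+ 1ℤ ℤ.* s))
    ring = solve-∀
  step (suc i) = trans
    (cong₂ (λ x y → taylor f n (suc i) ℤ.+ (n ℤ.* x ℤ.+ 1ℤ ℤ.* y))
      (taylor-derivative f n (suc i)) (taylor-derivative f n i))
    (ring n a (+ suc i) (taylor f n (suc i)) (taylor f n (suc (suc i))))
    where
    ring : ∀ n a k s t → s ℤ.+ (n ℤ.* ((1ℤ ℤ.+ k) ℤ.* t) ℤ.+ 1ℤ ℤ.* (k ℤ.* s))
                       ≡ (1ℤ ℤ.+ k) ℤ.* (a ℤ.* 0ℤ ℤ.+ (n ℤ.* t ℤ.+ 1ℤ ℤ.* s))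
    ring = solve-∀

-- The i-th derivative sends w^(i + j) to (i + j)! / j! times w^j; the factorials are multiplied out
-- to stay in ℤ.
taylor-⁽⁾ : ∀ f n i j → + (j !) ℤ.* taylor (f ⁽ i ⁾) n j ≡ + ((i + j) !) ℤ.* taylor f n (i + j)
taylor-⁽⁾ f n zero    j = refl
taylor-⁽⁾ f n (suc i) j = begin
  + (j !) ℤ.* taylor (derivative f ⁽ i ⁾) n j            ≡⟨ taylor-⁽⁾ (derivative f) n i j ⟩
  + ((i + j) !) ℤ.* taylor (derivative f) n (i + j)      ≡⟨ cong (+ ((i + j) !) ℤ.*_) (taylor-derivative f n (i + j)) ⟩
  + ((i + j) !) ℤ.* (+ suc (i + j) ℤ.* t)                ≡⟨ ring (+ ((i + j) !)) (+ suc (i + j)) t ⟩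
  + suc (i + j) ℤ.* + ((i + j) !) ℤ.* t                  ≡⟨ cong (ℤ._* t) (ℤₚ.pos-* (suc (i + j)) ((i + j) !)) ⟨
  + (suc (i + j) * (i + j) !) ℤ.* t                      ∎
  where
  open ≡-Reasoning
  t : ℤ
  t = taylor f n (suc (i + j))
  ring : ∀ a b t → a ℤ.* (b ℤ.* t) ≡ b ℤ.* a ℤ.* t
  ring = solve-∀

-- With quotient `q`, the remainder is `∣ x ℤ.- q ∣ * d`, and a multiple of `d` below `d` is zero.
*-/ℕ-cancel : ∀ x d .{{_ : ℕ.NonZero d}} → (x ℤ.* + d) ℤ./ℕ d ≡ x
*-/ℕ-cancel x d = sym (ℤₚ.i-j≡0⇒i≡j x q (ℤₚ.∣i∣≡0⇒i≡0 (vanish ∣ x ℤ.- q ∣ diff<d)))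
  where
  open ≡-Reasoning
  q : ℤ
  q = (x ℤ.* + d) ℤ./ℕ d
  r : ℕ
  r = (x ℤ.* + d) ℤ.%ℕ d
  ring₁ : ∀ x q d → (x ℤ.- q) ℤ.* d ≡ x ℤ.* d ℤ.- q ℤ.* d
  ring₁ = solve-∀
  ring₂ : ∀ r y → r ℤ.+ y ℤ.- y ≡ r
  ring₂ = solve-∀
  diff : ∣ x ℤ.- q ∣ * d ≡ r
  diff = begin
    ∣ x ℤ.- q ∣ * d                            ≡⟨ ℤₚ.abs-* (x ℤ.- q) (+ d) ⟨
    ∣ (x ℤ.- q) ℤ.* + d ∣                      ≡⟨ cong ∣_∣ (ring₁ x q (+ d)) ⟩
    ∣ x ℤ.* + d ℤ.- q ℤ.* + d ∣                ≡⟨ cong (λ y → ∣ y ℤ.- q ℤ.* + d ∣) (ℤ.a≡a%ℕn+[a/ℕn]*n (x ℤ.* + d) d) ⟩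
    ∣ + r ℤ.+ q ℤ.* + d ℤ.- q ℤ.* + d ∣        ≡⟨ cong ∣_∣ (ring₂ (+ r) (q ℤ.* + d)) ⟩
    r                                          ∎
  diff<d : ∣ x ℤ.- q ∣ * d < d
  diff<d = subst (_< d) (sym diff) (ℤ.n%ℕd<d (x ℤ.* + d) d)
  vanish : ∀ y → y * d < d → y ≡ 0
  vanish zero    _    = refl
  vanish (suc y) yd<d = contradiction yd<d (ℕₚ.≤⇒≯ (ℕₚ.m≤m+n d (y * d)))

dividedDerivative≡taylor : ∀ f i n → dividedDerivative f i n ≡ taylor f n i
dividedDerivative≡taylor f i n = trans (cong (λ x → (x ℤ./ℕ (i !)) {{i ℕₚ.!≢0}}) value)
  (*-/ℕ-cancel (taylor f n i) (i !) {{i ℕₚ.!≢0}})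
  where
  open ≡-Reasoning
  value : eval (f ⁽ i ⁾) n ≡ taylor f n i ℤ.* + (i !)
  value = begin
    eval (f ⁽ i ⁾) n                          ≡⟨ eval-act n 1ℤ (f ⁽ i ⁾) ⟩
    taylor (f ⁽ i ⁾) n 0                      ≡⟨ ℤₚ.*-identityˡ _ ⟨
    + (0 !) ℤ.* taylor (f ⁽ i ⁾) n 0          ≡⟨ taylor-⁽⁾ f n i 0 ⟩
    + ((i + 0) !) ℤ.* taylor f n (i + 0)      ≡⟨ cong (λ k → + (k !) ℤ.* taylor f n k) (ℕₚ.+-identityʳ i) ⟩
    + (i !) ℤ.* taylor f n i                  ≡⟨ ℤₚ.*-comm (+ (i !)) (taylor f n i) ⟩
    taylor f n i ℤ.* + (i !)                  ∎

-- Finite sums and truncated ℓ¹ norms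

sum-mono : ∀ {k} (s t : Vector ℕ k) → (∀ i → s i ≤ t i) → sum s ≤ sum t
sum-mono {zero}  s t s≤t = z≤n
sum-mono {suc k} s t s≤t = ℕₚ.+-mono-≤ (s≤t zero) (sum-mono _ _ (λ i → s≤t (suc i)))

sum-*ʳ : ∀ {k} (t : Vector ℕ k) x → sum (λ i → t i * x) ≡ sum t * x
sum-*ʳ {zero}  t x = refl
sum-*ʳ {suc k} t x = trans (cong (λ y → t zero * x + y) (sum-*ʳ (λ i → t (suc i)) x))
  (sym (ℕₚ.*-distribʳ-+ x (t zero) _))

sum-*ˡ : ∀ {k} x (t : Vector ℕ k) → sum (λ i → x * t i) ≡ x * sum t
sum-*ˡ {zero}  x t = sym (ℕₚ.*-zeroʳ x)
sum-*ˡ {suc k} x t = trans (cong (λ y → x * t zero + y) (sum-*ˡ x (λ i → t (suc i))))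
  (sym (ℕₚ.*-distribˡ-+ x (t zero) _))

norm : Seq → ℕ → ℕ
norm S zero    = 0
norm S (suc N) = norm S N + ∣ S N ∣

norm-cong : ∀ {S R} → S ≗ R → ∀ N → norm S N ≡ norm R N
norm-cong e zero    = refl
norm-cong e (suc N) = cong₂ _+_ (norm-cong e N) (cong ∣_∣ (e N))

norm-triangle : ∀ {S R T} → (∀ i → ∣ S i ∣ ≤ ∣ R i ∣ + ∣ T i ∣) → ∀ N → norm S N ≤ norm R N + norm T N
norm-triangle t zero    = z≤n
norm-triangle {S} {R} {T} t (suc N) = ℕₚ.≤-trans (ℕₚ.+-mono-≤ (norm-triangle {S} {R} {T} t N) (t N))
  (ℕₚ.≤-reflexive (ring (norm R N) (norm T N) _ _))
  where
  ring : ∀ a b c d → a + b + (c + d) ≡ a + c + (b + d)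
  ring = ℕ-Solver.solve-∀

norm-+ : ∀ S R N → norm (λ i → S i ℤ.+ R i) N ≤ norm S N + norm R N
norm-+ S R = norm-triangle {R = S} {T = R} (λ i → ℤₚ.∣i+j∣≤∣i∣+∣j∣ (S i) (R i))

norm-∸ : ∀ S R N → norm S N ≤ norm (λ i → S i ℤ.+ R i) N + norm R N
norm-∸ S R = norm-triangle {T = R} (λ i → subst (λ x → ∣ x ∣ ≤ ∣ S i ℤ.+ R i ∣ + ∣ R i ∣)
  (ring (S i) (R i)) (ℤₚ.∣i-j∣≤∣i∣+∣j∣ (S i ℤ.+ R i) (R i)))
  where
  ring : ∀ s r → s ℤ.+ r ℤ.- r ≡ s
  ring = solve-∀

norm-* : ∀ a S N → norm (λ i → a ℤ.* S i) N ≡ ∣ a ∣ * norm S N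
norm-* a S zero    = sym (ℕₚ.*-zeroʳ ∣ a ∣)
norm-* a S (suc N) = trans (cong₂ _+_ (norm-* a S N) (ℤₚ.abs-* a (S N)))
  (sym (ℕₚ.*-distribˡ-+ ∣ a ∣ (norm S N) _))

norm-δ : ∀ N → norm δ N ≤ 1
norm-δ zero          = z≤n
norm-δ (suc zero)    = ℕₚ.≤-refl
norm-δ (suc (suc N)) = subst (_≤ 1) (sym (ℕₚ.+-identityʳ _)) (norm-δ (suc N))

norm-vanishes : ∀ S s r → norm S (s + r) ≤ norm S s → ∀ {t} → t < r → S (s + t) ≡ 0ℤ
norm-vanishes S s r ≤s {t} t<r = ℤₚ.∣i∣≡0⇒i≡0 (ℕₚ.n≤0⇒n≡0 (ℕₚ.+-cancelˡ-≤ (norm S (s + t)) _ _ chain))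
  where
  open ℕₚ.≤-Reasoning
  mono : ∀ {M N} → M ≤ N → norm S M ≤ norm S N
  mono {M} {N} M≤N with ℕₚ.m≤n⇒m<n∨m≡n M≤N
  mono {M} {suc N} _ | inj₁ (s≤s M≤N) = ℕₚ.≤-trans (mono M≤N) (ℕₚ.m≤m+n _ _)
  mono             _ | inj₂ refl      = ℕₚ.≤-refl
  chain : norm S (s + t) + ∣ S (s + t) ∣ ≤ norm S (s + t) + 0
  chain = begin
    norm S (suc (s + t))   ≤⟨ mono (subst (_≤ s + r) (ℕₚ.+-suc s t) (ℕₚ.+-monoʳ-≤ s t<r)) ⟩
    norm S (s + r)         ≤⟨ ≤s ⟩
    norm S s               ≤⟨ mono (ℕₚ.m≤m+n s t) ⟩
    norm S (s + t)         ≡⟨ ℕₚ.+-identityʳ _ ⟨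
    norm S (s + t) + 0     ∎

shift : Seq → Seq
shift S zero    = 0ℤ
shift S (suc i) = S i

norm-shift : ∀ S N → norm (shift S) N ≤ norm S N
norm-shift S zero    = z≤n
norm-shift S (suc N) = ℕₚ.≤-trans (ℕₚ.≤-reflexive (exact N)) (ℕₚ.m≤m+n _ _)
  where
  exact : ∀ N → norm (shift S) (suc N) ≡ norm S N
  exact zero    = refl
  exact (suc N) = cong (_+ ∣ S N ∣) (exact N)

op-shift : ∀ n c S → op n c S ≗ λ i → n ℤ.* S i ℤ.+ c ℤ.* shift S i
op-shift n c S zero    = sym (trans (cong (λ x → n ℤ.* S 0 ℤ.+ x) (ℤₚ.*-zeroʳ c)) (ℤₚ.+-identityʳ _))
op-shift n c S (suc i) = refl

-- The new factor is applied to the argument first, matching `norm-act-∷`, where the tail of a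
-- polynomial acts on `op n c S`.
op^ : ℤ → ℤ → ℕ → Seq → Seq
op^ n c zero    S = S
op^ n c (suc i) S = op^ n c i (op n c S)

module _ (n c : ℤ) where

  norm-act-∷ : ∀ a f S N → norm (act n c (a ∷ f) S) N ≤ ∣ a ∣ * norm S N + norm (act n c f (op n c S)) N
  norm-act-∷ a f S N = ℕₚ.≤-trans (norm-+ (λ i → a ℤ.* S i) (op n c (act n c f S)) N)
    (ℕₚ.≤-reflexive (cong₂ _+_ (norm-* a S N) (norm-cong (λ i → sym (act-op n c f S i)) N)))

  norm-act-≤ : ∀ {k} (a : Vec ℤ k) S N →
    norm (act n c (toList a) S) N ≤ sum (λ i → ∣ lookup a i ∣ * norm (op^ n c (toℕ i) S) N)
  norm-act-≤ []      S N = ℕₚ.≤-reflexive (zeros N)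
    where
    zeros : ∀ N → norm (λ _ → 0ℤ) N ≡ 0
    zeros zero    = refl
    zeros (suc N) = trans (ℕₚ.+-identityʳ _) (zeros N)
  norm-act-≤ (x ∷ a) S N = ℕₚ.≤-trans (norm-act-∷ x (toList a) S N)
    (ℕₚ.+-monoʳ-≤ (∣ x ∣ * norm S N) (norm-act-≤ a (op n c S) N))

  -- Reverse triangle inequality for the sum over i of aᵢ (n + c w)^i S. The induction on `j` peels
  -- off the heads before position `j` one at a time and, on arrival, the whole tail at once.
  norm-term-≤ : ∀ {k} (a : Vec ℤ (suc k)) j S N →
    ∣ lookup a j ∣ * norm (op^ n c (toℕ j) S) N ≤
    norm (act n c (toList a) S) N + sum (removeAt (λ i → ∣ lookup a i ∣ * norm (op^ n c (toℕ i) S) N) j)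
  norm-term-≤ (x ∷ a) zero S N = begin
    ∣ x ∣ * norm S N                                    ≡⟨ norm-* x S N ⟨
    norm (λ i → x ℤ.* S i) N                            ≤⟨ norm-∸ (λ i → x ℤ.* S i) (op n c (act n c (toList a) S)) N ⟩
    norm (act n c (x ∷ toList a) S) N + norm (op n c (act n c (toList a) S)) N
      ≡⟨ cong (λ y → norm (act n c (x ∷ toList a) S) N + y) (norm-cong (act-op n c (toList a) S) N) ⟨
    norm (act n c (x ∷ toList a) S) N + norm (act n c (toList a) (op n c S)) N
      ≤⟨ ℕₚ.+-monoʳ-≤ _ (norm-act-≤ a (op n c S) N) ⟩
    norm (act n c (x ∷ toList a) S) N + _ ∎
    where open ℕₚ.≤-Reasoning
  norm-term-≤ {suc k} (x ∷ a) (suc j) S N = begin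
    ∣ lookup a j ∣ * norm (op^ n c (toℕ j) (op n c S)) N   ≤⟨ norm-term-≤ a j (op n c S) N ⟩
    norm (act n c (toList a) (op n c S)) N + rest          ≡⟨ cong (_+ rest) (norm-cong (act-op n c (toList a) S) N) ⟩
    norm (op n c (act n c (toList a) S)) N + rest          ≤⟨ ℕₚ.+-monoˡ-≤ rest (norm-∸ (op n c (act n c (toList a) S)) (λ i → x ℤ.* S i) N) ⟩
    norm (λ i → op n c (act n c (toList a) S) i ℤ.+ x ℤ.* S i) N + norm (λ i → x ℤ.* S i) N + rest
      ≡⟨ cong₂ (λ u v → u + v + rest) (norm-cong (λ i → ℤₚ.+-comm _ (x ℤ.* S i)) N) (norm-* x S N) ⟩
    norm (act n c (x ∷ toList a) S) N + ∣ x ∣ * norm S N + rest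
      ≡⟨ ℕₚ.+-assoc (norm (act n c (x ∷ toList a) S) N) _ _ ⟩
    norm (act n c (x ∷ toList a) S) N + (∣ x ∣ * norm S N + rest) ∎
    where
    open ℕₚ.≤-Reasoning
    rest : ℕ
    rest = sum (removeAt (λ i → ∣ lookup a i ∣ * norm (op^ n c (toℕ i) (op n c S)) N) j)

-- On ℓ¹, multiplication by n + c w with |c| ≤ d scales norms by a factor
-- between n ∸ d and n + d.
module _ {A d : ℕ} {c : ℤ} (∣c∣≤d : ∣ c ∣ ≤ d) where

  private
    n : ℤ
    n = + (A + d)

    norm-c : ∀ S N → norm (λ i → c ℤ.* shift S i) N ≤ d * norm S N
    norm-c S N = ℕₚ.≤-trans (ℕₚ.≤-reflexive (norm-* c (shift S) N)) (ℕₚ.*-mono-≤ ∣c∣≤d (norm-shift S N))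

  norm-op-≤ : ∀ S N → norm (op n c S) N ≤ (A + d + d) * norm S N
  norm-op-≤ S N = begin
    norm (op n c S) N                                            ≡⟨ norm-cong (op-shift n c S) N ⟩
    norm (λ i → n ℤ.* S i ℤ.+ c ℤ.* shift S i) N                 ≤⟨ norm-+ (λ i → n ℤ.* S i) (λ i → c ℤ.* shift S i) N ⟩
    norm (λ i → n ℤ.* S i) N + norm (λ i → c ℤ.* shift S i) N    ≤⟨ ℕₚ.+-mono-≤ (ℕₚ.≤-reflexive (norm-* n S N)) (norm-c S N) ⟩
    (A + d) * norm S N + d * norm S N                            ≡⟨ ℕₚ.*-distribʳ-+ (norm S N) (A + d) d ⟨
    (A + d + d) * norm S N                                       ∎
    where open ℕₚ.≤-Reasoning

  norm-op-≥ : ∀ S N → A * norm S N ≤ norm (op n c S) N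
  norm-op-≥ S N = ℕₚ.+-cancelʳ-≤ (d * norm S N) _ _ (begin
    A * norm S N + d * norm S N                        ≡⟨ ℕₚ.*-distribʳ-+ (norm S N) A d ⟨
    (A + d) * norm S N                                 ≡⟨ norm-* n S N ⟨
    norm (λ i → n ℤ.* S i) N                           ≤⟨ norm-∸ (λ i → n ℤ.* S i) (λ i → c ℤ.* shift S i) N ⟩
    norm (λ i → n ℤ.* S i ℤ.+ c ℤ.* shift S i) N + norm (λ i → c ℤ.* shift S i) N
      ≤⟨ ℕₚ.+-mono-≤ (ℕₚ.≤-reflexive (sym (norm-cong (op-shift n c S) N))) (norm-c S N) ⟩
    norm (op n c S) N + d * norm S N                   ∎)
    where open ℕₚ.≤-Reasoning

  -- Lowering both exponents together leaves either `j ∸ i` uses of `norm-op-≥`, each consuming one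
  -- factor `A` of `A ^ j`, or `i ∸ j` uses of `norm-op-≤`.
  norm-op^ : ∀ i j S N → A ^ j * norm (op^ n c i S) N ≤ A ^ (i ⊓ j) * (A + d + d) ^ (i ∸ j) * norm (op^ n c j S) N
  norm-op^ zero zero S N = ℕₚ.≤-refl
  norm-op^ zero (suc j) S N = begin
    A * A ^ j * norm S N                   ≡⟨ cong (_* norm S N) (ℕₚ.*-comm A (A ^ j)) ⟩
    A ^ j * A * norm S N                   ≡⟨ ℕₚ.*-assoc (A ^ j) A (norm S N) ⟩
    A ^ j * (A * norm S N)                 ≤⟨ ℕₚ.*-monoʳ-≤ (A ^ j) (norm-op-≥ S N) ⟩
    A ^ j * norm (op n c S) N              ≤⟨ norm-op^ zero j (op n c S) N ⟩
    1 * (A + d + d) ^ (0 ∸ j) * norm (op^ n c j (op n c S)) N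
      ≡⟨ cong (λ k → 1 * (A + d + d) ^ k * norm (op^ n c j (op n c S)) N) (ℕₚ.0∸n≡0 j) ⟩
    1 * 1 * norm (op^ n c j (op n c S)) N  ∎
    where open ℕₚ.≤-Reasoning
  norm-op^ (suc i) zero S N = begin
    1 * norm (op^ n c i (op n c S)) N      ≤⟨ norm-op^ i zero (op n c S) N ⟩
    A ^ (i ⊓ 0) * B ^ (i ∸ 0) * norm (op n c S) N
      ≡⟨ cong (λ k → A ^ k * B ^ i * norm (op n c S) N) (ℕₚ.⊓-zeroʳ i) ⟩
    1 * B ^ i * norm (op n c S) N          ≤⟨ ℕₚ.*-monoʳ-≤ (1 * B ^ i) (norm-op-≤ S N) ⟩
    1 * B ^ i * (B * norm S N)             ≡⟨ ring B (B ^ i) (norm S N) ⟩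
    1 * (B * B ^ i) * norm S N             ∎
    where
    open ℕₚ.≤-Reasoning
    B : ℕ
    B = A + d + d
    ring : ∀ b c s → 1 * c * (b * s) ≡ 1 * (b * c) * s
    ring = ℕ-Solver.solve-∀
  norm-op^ (suc i) (suc j) S N = begin
    A * A ^ j * norm (op^ n c i (op n c S)) N     ≡⟨ ℕₚ.*-assoc A (A ^ j) _ ⟩
    A * (A ^ j * norm (op^ n c i (op n c S)) N)   ≤⟨ ℕₚ.*-monoʳ-≤ A (norm-op^ i j (op n c S) N) ⟩
    A * (A ^ (i ⊓ j) * (A + d + d) ^ (i ∸ j) * norm (op^ n c j (op n c S)) N)
      ≡⟨ ring A (A ^ (i ⊓ j)) ((A + d + d) ^ (i ∸ j)) _ ⟩
    A * A ^ (i ⊓ j) * (A + d + d) ^ (i ∸ j) * norm (op^ n c j (op n c S)) N ∎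
    where
    open ℕₚ.≤-Reasoning
    ring : ∀ a b c s → a * (b * c * s) ≡ a * b * c * s
    ring = ℕ-Solver.solve-∀

  -- `K` is the polynomial with coefficients ∣aᵢ∣ evaluated at A + d + d by Horner's scheme. What
  -- matters is that it depends on neither `S` nor `N`.
  norm-act-bounded : ∀ f → ∃ λ K → ∀ S N → norm (act n c f S) N ≤ K * norm S N
  norm-act-bounded []      = 0 , λ S N → norm-act-≤ n c [] S N
  norm-act-bounded (a ∷ f) with norm-act-bounded f
  ... | K , bound = ∣ a ∣ + K * (A + d + d) , λ S N → begin
    norm (act n c (a ∷ f) S) N                             ≤⟨ norm-act-∷ n c a f S N ⟩
    ∣ a ∣ * norm S N + norm (act n c f (op n c S)) N       ≤⟨ ℕₚ.+-monoʳ-≤ _ (bound (op n c S) N) ⟩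
    ∣ a ∣ * norm S N + K * norm (op n c S) N               ≤⟨ ℕₚ.+-monoʳ-≤ _ (ℕₚ.*-monoʳ-≤ K (norm-op-≤ S N)) ⟩
    ∣ a ∣ * norm S N + K * ((A + d + d) * norm S N)        ≡⟨ ring ∣ a ∣ K (A + d + d) (norm S N) ⟩
    (∣ a ∣ + K * (A + d + d)) * norm S N                   ∎
    where
    open ℕₚ.≤-Reasoning
    ring : ∀ a k b s → a * s + k * (b * s) ≡ (a + k * b) * s
    ring = ℕ-Solver.solve-∀

  -- Strict dominance between natural numbers leaves a gap of at least 1. After scaling by `A ^ J`,
  -- the j-th term therefore exceeds the bound for all other terms by at least `T`, so `T` is at
  -- most `A ^ J * P`. This lower bound for the action of `f` takes the place of an inverse of
  -- `f (n + c w)`.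
  norm-dominant : ∀ {m} (a : Vec ℤ (suc m)) (j : Fin (suc m)) → 1 ≤ A →
    sum (removeAt (λ i → ∣ lookup a i ∣ * (A ^ (toℕ i ⊓ toℕ j) * (A + d + d) ^ (toℕ i ∸ toℕ j))) j)
      < ∣ lookup a j ∣ * A ^ toℕ j →
    ∀ S N → norm S N ≤ A ^ toℕ j * norm (act n c (toList a) S) N
  norm-dominant {m} a j 1≤A dom S N = ℕₚ.≤-trans S≤T (ℕₚ.+-cancelʳ-≤ (L * T) _ _ T≤)
    where
    open ℕₚ.≤-Reasoning
    J P T L : ℕ
    J = toℕ j
    P = norm (act n c (toList a) S) N
    T = norm (op^ n c J S) N
    w : Fin (suc m) → ℕ
    w i = A ^ (toℕ i ⊓ J) * (A + d + d) ^ (toℕ i ∸ J)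
    t : Fin (suc m) → ℕ
    t i = ∣ lookup a i ∣ * norm (op^ n c (toℕ i) S) N
    L = sum (removeAt (λ i → ∣ lookup a i ∣ * w i) j)
    instance
      A≢0 : ℕ.NonZero A
      A≢0 = ℕ.>-nonZero 1≤A
    S≤T : norm S N ≤ T
    S≤T = begin
      norm S N              ≤⟨ ℕₚ.m≤n*m (norm S N) (A ^ J) {{ℕₚ.m^n≢0 A J}} ⟩
      A ^ J * norm S N      ≤⟨ norm-op^ 0 J S N ⟩
      1 * (A + d + d) ^ (0 ∸ J) * T  ≡⟨ cong (λ k → 1 * (A + d + d) ^ k * T) (ℕₚ.0∸n≡0 J) ⟩
      1 * 1 * T             ≡⟨ ℕₚ.*-identityˡ T ⟩
      T                     ∎
    rest : A ^ J * sum (removeAt t j) ≤ L * T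
    rest = begin
      A ^ J * sum (removeAt t j)                      ≡⟨ sum-*ˡ (A ^ J) (removeAt t j) ⟨
      sum (λ i → A ^ J * removeAt t j i)              ≤⟨ sum-mono _ _ (λ i → each (punchIn j i)) ⟩
      sum (λ i → removeAt (λ i → ∣ lookup a i ∣ * w i) j i * T)
        ≡⟨ sum-*ʳ (removeAt (λ i → ∣ lookup a i ∣ * w i) j) T ⟩
      L * T                                           ∎
      where
      each : ∀ i → A ^ J * t i ≤ ∣ lookup a i ∣ * w i * T
      each i = begin
        A ^ J * (∣ lookup a i ∣ * norm (op^ n c (toℕ i) S) N)    ≡⟨ swap (A ^ J) ∣ lookup a i ∣ _ ⟩
        ∣ lookup a i ∣ * (A ^ J * norm (op^ n c (toℕ i) S) N)    ≤⟨ ℕₚ.*-monoʳ-≤ ∣ lookup a i ∣ (norm-op^ (toℕ i) J S N) ⟩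
        ∣ lookup a i ∣ * (w i * T)                               ≡⟨ ℕₚ.*-assoc ∣ lookup a i ∣ (w i) T ⟨
        ∣ lookup a i ∣ * w i * T                                 ∎
        where
        swap : ∀ x y z → x * (y * z) ≡ y * (x * z)
        swap = ℕ-Solver.solve-∀
    T≤ : T + L * T ≤ A ^ J * P + L * T
    T≤ = begin
      suc L * T                             ≤⟨ ℕₚ.*-monoˡ-≤ T dom ⟩
      ∣ lookup a j ∣ * A ^ J * T            ≡⟨ rot ∣ lookup a j ∣ (A ^ J) T ⟩
      A ^ J * (∣ lookup a j ∣ * T)          ≤⟨ ℕₚ.*-monoʳ-≤ (A ^ J) (norm-term-≤ n c a j S N) ⟩
      A ^ J * (P + sum (removeAt t j))      ≡⟨ ℕₚ.*-distribˡ-+ (A ^ J) P _ ⟩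
      A ^ J * P + A ^ J * sum (removeAt t j) ≤⟨ ℕₚ.+-monoʳ-≤ (A ^ J * P) rest ⟩
      A ^ J * P + L * T                     ∎
      where
      rot : ∀ x y z → x * y * z ≡ y * (x * z)
      rot = ℕ-Solver.solve-∀

-- Power series inverse of 1 + w Z.

dot : Seq → List ℤ → ℤ
dot Z []       = 0ℤ
dot Z (x ∷ xs) = Z 0 ℤ.* x ℤ.+ dot (λ i → Z (suc i)) xs

-- The coefficients k, …, 1, 0 of the inverse, in this order.
inverse-prefix : Seq → ℕ → List ℤ
inverse-prefix Z zero    = 1ℤ ∷ []
inverse-prefix Z (suc k) = - dot Z (inverse-prefix Z k) ∷ inverse-prefix Z k

inverse : Seq → Seq
inverse Z zero    = 1ℤ
inverse Z (suc k) = - dot Z (inverse-prefix Z k)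

dot-inverse : ∀ Z W k → dot W (inverse-prefix Z k) ≡ (W ⋆ inverse Z) k
dot-inverse Z W zero    = ℤₚ.+-identityʳ _
dot-inverse Z W (suc k) = cong (λ x → W 0 ℤ.* inverse Z (suc k) ℤ.+ x) (dot-inverse Z (λ i → W (suc i)) k)

⋆-inverse : ∀ W → W 0 ≡ 1ℤ → W ⋆ inverse (λ i → W (suc i)) ≗ δ
⋆-inverse W W₀≡1 zero    = trans (ℤₚ.*-identityʳ (W 0)) W₀≡1
⋆-inverse W W₀≡1 (suc k) = begin
  W 0 ℤ.* - dot Z (inverse-prefix Z k) ℤ.+ (Z ⋆ inverse Z) k
    ≡⟨ cong₂ (λ x y → x ℤ.* - dot Z (inverse-prefix Z k) ℤ.+ y) W₀≡1 (sym (dot-inverse Z Z k)) ⟩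
  1ℤ ℤ.* - dot Z (inverse-prefix Z k) ℤ.+ dot Z (inverse-prefix Z k)
    ≡⟨ ring (dot Z (inverse-prefix Z k)) ⟩
  0ℤ ∎
  where
  open ≡-Reasoning
  Z : Seq
  Z i = W (suc i)
  ring : ∀ x → 1ℤ ℤ.* - x ℤ.+ x ≡ 0ℤ
  ring = solve-∀

⋆-*ˡ : ∀ a S R k → ((λ i → a ℤ.* S i) ⋆ R) k ≡ a ℤ.* (S ⋆ R) k
⋆-*ˡ a S R k = begin
  ((λ i → a ℤ.* S i) ⋆ R) k                       ≡⟨ ⋆-congˡ R (λ i → ring (a ℤ.* S i) (S i)) k ⟩
  ((λ i → a ℤ.* S i ℤ.+ 0ℤ ℤ.* S i) ⋆ R) k        ≡⟨ ⋆-lincomb a 0ℤ S S R k ⟩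
  a ℤ.* (S ⋆ R) k ℤ.+ 0ℤ ℤ.* (S ⋆ R) k            ≡⟨ ring (a ℤ.* (S ⋆ R) k) ((S ⋆ R) k) ⟨
  a ℤ.* (S ⋆ R) k                                 ∎
  where
  open ≡-Reasoning
  ring : ∀ x y → x ≡ x ℤ.+ 0ℤ ℤ.* y
  ring = solve-∀

-- g (n + c w) = g n + c w (…); when c = g n, this is c times an integral
-- power series with constant term 1, hence invertible up to the factor c.
act-solve : ∀ n g → ∃ λ Q → Q 0 ≡ 1ℤ × act n (eval g n) g Q ≗ λ i → eval g n ℤ.* δ i
act-solve n g = inverse (quot g) , refl , λ i → begin
  act n c g Q i                     ≡⟨ act-⋆ n c g Q i ⟩
  (act n c g δ ⋆ Q) i               ≡⟨ ⋆-congˡ Q factor i ⟩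
  ((λ i → c ℤ.* W i) ⋆ Q) i         ≡⟨ ⋆-*ˡ c W Q i ⟩
  c ℤ.* (W ⋆ Q) i                   ≡⟨ cong (c ℤ.*_) (⋆-inverse W refl i) ⟩
  c ℤ.* δ i                         ∎
  where
  open ≡-Reasoning
  c : ℤ
  c = eval g n
  -- `quot` of a polynomial is its value at n + c w minus its value at n, divided by c w. In the
  -- recursion `c` stays the value of the whole `g`, not of the current tail.
  quot : Poly → Seq
  quot []      i = 0ℤ
  quot (a ∷ g) i = n ℤ.* quot g i ℤ.+ act n c g δ i
  Q : Seq
  Q = inverse (quot g)
  W : Seq
  W zero    = 1ℤ
  W (suc i) = quot g i
  quot-correct : ∀ g i → act n c g δ (suc i) ≡ c ℤ.* quot g i
  quot-correct []      i = sym (ℤₚ.*-zeroʳ c)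
  quot-correct (a ∷ g) i = trans
    (cong (λ x → a ℤ.* 0ℤ ℤ.+ (n ℤ.* x ℤ.+ c ℤ.* act n c g δ i)) (quot-correct g i))
    (ring a n c (quot g i) (act n c g δ i))
    where
    ring : ∀ a n c q x → a ℤ.* 0ℤ ℤ.+ (n ℤ.* (c ℤ.* q) ℤ.+ c ℤ.* x) ≡ c ℤ.* (n ℤ.* q ℤ.+ x)
    ring = solve-∀
  factor : act n c g δ ≗ λ i → c ℤ.* W i
  factor zero    = trans (sym (eval-act n c g)) (sym (ℤₚ.*-identityʳ c))
  factor (suc i) = quot-correct g i

-- Degree and growth of the inverse series

HasDegree : Poly → ℕ → Set
HasDegree g r = coeff g r ≢ 0ℤ × (∀ i → r < i → coeff g i ≡ 0ℤ)

degree : ∀ g → (∀ i → coeff g i ≡ 0ℤ) ⊎ ∃ (HasDegree g)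
degree [] = inj₁ λ _ → refl
degree (a ∷ g) with degree g
... | inj₂ (r , gᵣ≢0 , above) = inj₂ (suc r , gᵣ≢0 , λ { (suc i) (s≤s r<i) → above i r<i })
... | inj₁ g≈0 with a ℤₚ.≟ 0ℤ
...   | yes a≡0 = inj₁ λ { zero → a≡0 ; (suc i) → g≈0 i }
...   | no  a≢0 = inj₂ (0 , a≢0 , λ { (suc i) _ → g≈0 i })

-- Coefficient s + r of the product involves S at s + r and earlier. The coefficients of
-- `g (n + c w)` above w^r vanish and so do the r entries of S after s; only the coefficient of w^r,
-- which is the leading coefficient times c^r, meets a possibly nonzero entry, `S s`.
act-lead : ∀ n c g r → (∀ i → r < i → coeff g i ≡ 0ℤ) → ∀ S s →
           (∀ t → t < r → S (suc s + t) ≡ 0ℤ) → act n c g S (s + r) ≡ coeff g r ℤ.* c ℤ.^ r ℤ.* S s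
act-lead n c [] r above S s window = refl
act-lead n c (a ∷ g) zero above S s window = begin
  a ℤ.* S (s + 0) ℤ.+ op n c (act n c g S) (s + 0)
    ≡⟨ cong₂ (λ i x → a ℤ.* S i ℤ.+ x) (ℕₚ.+-identityʳ s)
         (op-0 n c (act-≈0 n c g S (λ i → above (suc i) (s≤s z≤n))) (s + 0)) ⟩
  a ℤ.* S s ℤ.+ 0ℤ
    ≡⟨ ring a (S s) ⟩
  a ℤ.* 1ℤ ℤ.* S s ∎
  where
  open ≡-Reasoning
  ring : ∀ a s → a ℤ.* s ℤ.+ 0ℤ ≡ a ℤ.* 1ℤ ℤ.* s
  ring = solve-∀
act-lead n c (a ∷ g) (suc r) above S s window rewrite ℕₚ.+-suc s r = begin
  a ℤ.* S (suc s + r) ℤ.+ (n ℤ.* act n c g S (suc s + r) ℤ.+ c ℤ.* act n c g S (s + r))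
    ≡⟨ cong₂ (λ x y → a ℤ.* x ℤ.+ (n ℤ.* y ℤ.+ c ℤ.* act n c g S (s + r)))
         (window r (ℕₚ.n<1+n r)) top ⟩
  a ℤ.* 0ℤ ℤ.+ (n ℤ.* (coeff g r ℤ.* c ℤ.^ r ℤ.* 0ℤ) ℤ.+ c ℤ.* act n c g S (s + r))
    ≡⟨ cong (λ x → a ℤ.* 0ℤ ℤ.+ (n ℤ.* (coeff g r ℤ.* c ℤ.^ r ℤ.* 0ℤ) ℤ.+ c ℤ.* x))
         (act-lead n c g r above′ S s (λ t t<r → window t (ℕₚ.m<n⇒m<1+n t<r))) ⟩
  a ℤ.* 0ℤ ℤ.+ (n ℤ.* (coeff g r ℤ.* c ℤ.^ r ℤ.* 0ℤ) ℤ.+ c ℤ.* (coeff g r ℤ.* c ℤ.^ r ℤ.* S s))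
    ≡⟨ ring a n c (coeff g r) (c ℤ.^ r) (S s) ⟩
  coeff g r ℤ.* (c ℤ.* c ℤ.^ r) ℤ.* S s ∎
  where
  open ≡-Reasoning
  above′ : ∀ i → r < i → coeff g i ≡ 0ℤ
  above′ i r<i = above (suc i) (s≤s r<i)
  shifted : ∀ t → t < r → S (suc (suc s) + t) ≡ 0ℤ
  shifted t t<r = trans (cong S (sym (ℕₚ.+-suc (suc s) t))) (window (suc t) (s≤s t<r))
  top : act n c g S (suc s + r) ≡ coeff g r ℤ.* c ℤ.^ r ℤ.* 0ℤ
  top = trans (act-lead n c g r above′ S (suc s) shifted)
    (cong (λ x → coeff g r ℤ.* c ℤ.^ r ℤ.* x)
      (trans (cong S (sym (ℕₚ.+-identityʳ (suc s)))) (window 0 (s≤s z≤n))))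
  ring : ∀ a n c g e x → a ℤ.* 0ℤ ℤ.+ (n ℤ.* (g ℤ.* e ℤ.* 0ℤ) ℤ.+ c ℤ.* (g ℤ.* e ℤ.* x))
                       ≡ g ℤ.* (c ℤ.* e) ℤ.* x
  ring = solve-∀

module _ {c : ℤ} {r : ℕ} {Q : Seq} (n : ℤ) (g : Poly) (c≢0 : c ≢ 0ℤ) (deg : HasDegree g (suc r))
         (Q₀≡1 : Q 0 ≡ 1ℤ) (gQ≡c : act n c g Q ≗ λ i → c ℤ.* δ i) where

  -- Zeros propagate backwards: a window as long as the degree forces, by `act-lead`, the entry
  -- before it to vanish, because the product is the constant c. Sliding down in this way reaches
  -- `Q 0`, which is 1.
  window-nonzero : ∀ s → ¬ (∀ t → t < suc r → Q (s + t) ≡ 0ℤ)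
  window-nonzero zero    window = contradiction (trans (sym Q₀≡1) (window 0 (s≤s z≤n))) λ ()
  window-nonzero (suc s) window = window-nonzero s λ
    { zero    _         → trans (cong Q (ℕₚ.+-identityʳ s)) Qₛ≡0
    ; (suc t) (s≤s t<r) → trans (cong Q (ℕₚ.+-suc s t)) (window t (ℕₚ.m<n⇒m<1+n t<r)) }
    where
    product≡0 : coeff g (suc r) ℤ.* c ℤ.^ suc r ℤ.* Q s ≡ 0ℤ
    product≡0 = trans (sym (act-lead n c g (suc r) (proj₂ deg) Q s window))
      (trans (gQ≡c (s + suc r)) (trans (cong (λ i → c ℤ.* δ i) (ℕₚ.+-suc s r)) (ℤₚ.*-zeroʳ c)))
    power≢0 : ∀ k → c ℤ.^ k ≢ 0ℤ
    power≢0 (suc k) e = [ c≢0 , power≢0 k ]′ (ℤₚ.i*j≡0⇒i≡0∨j≡0 c e)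
    Qₛ≡0 : Q s ≡ 0ℤ
    Qₛ≡0 with ℤₚ.i*j≡0⇒i≡0∨j≡0 (coeff g (suc r) ℤ.* c ℤ.^ suc r) product≡0
    ... | inj₂ e = e
    ... | inj₁ e = contradiction (ℤₚ.i*j≡0⇒i≡0∨j≡0 (coeff g (suc r)) e) [ proj₁ deg , power≢0 (suc r) ]′

  -- Each block of `suc r` coefficients contains a nonzero integer and so adds at least 1.
  norm-unbounded : ∀ k → k ≤ norm Q (k * suc r)
  norm-unbounded zero    = z≤n
  norm-unbounded (suc k) = ℕₚ.≤-<-trans (norm-unbounded k)
    (subst (λ N → norm Q (k * suc r) < norm Q N) (ℕₚ.+-comm (k * suc r) (suc r)) grows)
    where
    grows : norm Q (k * suc r) < norm Q (k * suc r + suc r)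
    grows = ℕₚ.≰⇒> λ ≤ → window-nonzero (k * suc r) (λ t → norm-vanishes Q (k * suc r) (suc r) ≤)

factor-large : ∀ {m A d r} (a : Vec ℤ (suc m)) (j : Fin (suc m)) → 1 ≤ A →
  sum (removeAt (λ i → ∣ lookup a i ∣ * (A ^ (toℕ i ⊓ toℕ j) * (A + d + d) ^ (toℕ i ∸ toℕ j))) j)
    < ∣ lookup a j ∣ * A ^ toℕ j →
  ∀ g h → toList a ≈ₚ g *ₚ h → eval g (+ (A + d)) ≢ 0ℤ → HasDegree g (suc r) →
  d < ∣ eval g (+ (A + d)) ∣
factor-large {A = A} {d} {r} a j 1≤A dom g h f≈gh c≢0 deg = ℕₚ.≰⇒> λ ∣c∣≤d → bounded ∣c∣≤d
  where
  open ℕₚ.≤-Reasoning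
  n c : ℤ
  n = + (A + d)
  c = eval g n
  bounded : ¬ ∣ c ∣ ≤ d
  bounded ∣c∣≤d with act-solve n g | norm-act-bounded {A} {d} {c} ∣c∣≤d h
  ... | Q , Q₀≡1 , gQ≡c | K , bound = ℕₚ.<-irrefl refl (begin-strict
    M                        <⟨ norm-unbounded n g c≢0 deg Q₀≡1 gQ≡c (suc M) ⟩
    norm Q N                 ≤⟨ norm-dominant ∣c∣≤d a j 1≤A dom Q N ⟩
    A ^ toℕ j * norm (act n c (toList a) Q) N     ≡⟨ cong (A ^ toℕ j *_) (norm-cong f·Q N) ⟩
    A ^ toℕ j * norm (act n c h (λ i → c ℤ.* δ i)) N  ≤⟨ ℕₚ.*-monoʳ-≤ (A ^ toℕ j) (bound _ N) ⟩
    A ^ toℕ j * (K * norm (λ i → c ℤ.* δ i) N)    ≡⟨ cong (λ x → A ^ toℕ j * (K * x)) (norm-* c δ N) ⟩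
    A ^ toℕ j * (K * (∣ c ∣ * norm δ N))          ≤⟨ ℕₚ.*-monoʳ-≤ (A ^ toℕ j) (ℕₚ.*-monoʳ-≤ K (ℕₚ.*-monoʳ-≤ ∣ c ∣ (norm-δ N))) ⟩
    M                        ∎)
    where
    -- The bound `M` does not involve the truncation, so `N` can be chosen afterwards, as `suc M`
    -- blocks of length `suc r`.
    M N : ℕ
    M = A ^ toℕ j * (K * (∣ c ∣ * 1))
    N = suc M * suc r
    f·Q : act n c (toList a) Q ≗ act n c h (λ i → c ℤ.* δ i)
    f·Q i = trans (act-≈ n c (toList a) (g *ₚ h) Q f≈gh i) (trans (act-*ₚ n c g h Q i)
      (trans (act-comm n c g h Q i) (act-cong n c h gQ≡c i)))

-- Convolution sums and predicates closed under addition

module _ {P : ℤ → Set} (P-0 : P 0ℤ) (P-+ : ∀ {x y} → P x → P y → P (x ℤ.+ y)) where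

  ⋆-all : ∀ S R k → (∀ i j → i + j ≡ k → P (S i ℤ.* R j)) → P ((S ⋆ R) k)
  ⋆-all S R zero    terms = terms 0 0 refl
  ⋆-all S R (suc k) terms = P-+ (terms 0 (suc k) refl)
    (⋆-all (λ i → S (suc i)) R k (λ i j i+j≡k → terms (suc i) j (cong suc i+j≡k)))

  ⋆-split : ∀ S R i₀ j₀ → (∀ i j → i + j ≡ i₀ + j₀ → i ≢ i₀ → P (S i ℤ.* R j)) →
            ∃ λ x → (S ⋆ R) (i₀ + j₀) ≡ S i₀ ℤ.* R j₀ ℤ.+ x × P x
  ⋆-split S R zero zero terms = 0ℤ , sym (ℤₚ.+-identityʳ _) , P-0
  ⋆-split S R zero (suc j) terms = _ , refl ,
    ⋆-all (λ i → S (suc i)) R j (λ i j i+j≡ → terms (suc i) j (cong suc i+j≡) λ ())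
  ⋆-split S R (suc i₀) j₀ terms
    with x , eq , Px ← ⋆-split (λ i → S (suc i)) R i₀ j₀
           (λ i j i+j≡ i≢i₀ → terms (suc i) j (cong suc i+j≡) (λ e → i≢i₀ (ℕₚ.suc-injective e)))
    = S 0 ℤ.* R (suc (i₀ + j₀)) ℤ.+ x
    , trans (cong (λ y → S 0 ℤ.* R (suc (i₀ + j₀)) ℤ.+ y) eq) (ring (S 0 ℤ.* R (suc (i₀ + j₀))) (S (suc i₀) ℤ.* R j₀) x)
    , P-+ (terms 0 (suc (i₀ + j₀)) refl λ ()) Px
    where
    ring : ∀ a b c → a ℤ.+ (b ℤ.+ c) ≡ b ℤ.+ (a ℤ.+ c)
    ring = solve-∀

  -- The contrapositive of `⋆-all`, made constructive by searching the finitely many terms.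
  ⋆-witness : Decidable P → ∀ S R k → ¬ P ((S ⋆ R) k) → ∃₂ λ i j → i + j ≡ k × ¬ P (S i ℤ.* R j)
  ⋆-witness P? S R zero    ¬P = 0 , 0 , refl , ¬P
  ⋆-witness P? S R (suc k) ¬P with P? (S 0 ℤ.* R (suc k))
  ... | no ¬head = 0 , suc k , refl , ¬head
  ... | yes head with ⋆-witness P? (λ i → S (suc i)) R k (λ tail → ¬P (P-+ head tail))
  ...   | i , j , i+j≡k , ¬Pij = suc i , j , cong suc i+j≡k , ¬Pij

first-failure : ∀ {P : ℕ → Set} → Decidable P → ∀ N →
                (∀ i → i < N → P i) ⊎ ∃ λ i → ¬ P i × (∀ j → j < i → P j)
first-failure P? zero = inj₁ λ _ ()
first-failure P? (suc N) with first-failure P? N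
... | inj₂ found = inj₂ found
... | inj₁ below with P? N
...   | no ¬PN = inj₂ (N , ¬PN , below)
...   | yes PN = inj₁ λ i i<1+N → [ below i , (λ { refl → PN }) ]′ (ℕₚ.m<1+n⇒m<n∨m≡n i<1+N)

-- Divisibility and p-adic valuations

∣ℤ-+ : ∀ {q} x y → q ∣ℕ ∣ x ∣ → q ∣ℕ ∣ y ∣ → q ∣ℕ ∣ x ℤ.+ y ∣
∣ℤ-+ {q} x y q∣x q∣y = Signed.∣⇒∣ᵤ {+ q} {x ℤ.+ y}
  (Signed.∣m∣n⇒∣m+n (Signed.∣ᵤ⇒∣ {+ q} {x} q∣x) (Signed.∣ᵤ⇒∣ {+ q} {y} q∣y))

^-∣ : ∀ p {e e′} → e ≤ e′ → p ^ e ∣ℕ p ^ e′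
^-∣ p {e} {e′} e≤e′ = ℕ∣.divides (p ^ (e′ ∸ e))
  (trans (cong (p ^_) (sym (ℕₚ.m∸n+n≡m e≤e′))) (ℕₚ.^-distribˡ-+-* p (e′ ∸ e) e))

module _ {p : ℕ} (p-prime : Prime p) where

  private instance
    p≢0 : ℕ.NonZero p
    p≢0 = prime⇒nonZero p-prime

  ∤-* : ∀ {x y} → p ∤ℕ x → p ∤ℕ y → p ∤ℕ x * y
  ∤-* {x} {y} p∤x p∤y p∣xy = [ p∤x , p∤y ]′ (euclidsLemma x y p-prime p∣xy)

  ^∣^*⇒≤ : ∀ {e u x} → p ∤ℕ x → p ^ e ∣ℕ p ^ u * x → e ≤ u
  ^∣^*⇒≤ {e} {u} {x} p∤x pᵉ∣ = ℕₚ.≮⇒≥ λ u<e → p∤x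
    (ℕ∣.*-cancelˡ-∣ (p ^ u) {{ℕₚ.m^n≢0 p u}}
      (subst (_∣ℕ p ^ u * x) (ℕₚ.*-comm p (p ^ u)) (ℕ∣.∣-trans (^-∣ p u<e) pᵉ∣)))

  -- The hypothesis serves both as the proof that x is nonzero and, through `N`, as the measure on
  -- which the recursion descends.
  valuation : ∀ N {x} → ¬ (p ^ N ∣ℕ x) → ∃₂ λ u y → x ≡ p ^ u * y × p ∤ℕ y
  valuation zero    {x} ¬1∣x = contradiction (ℕ∣.1∣ x) ¬1∣x
  valuation (suc N) {x} ¬p∣x with p ℕ∣.∣? x
  ... | no p∤x = 0 , x , sym (ℕₚ.*-identityˡ x) , p∤x
  ... | yes (ℕ∣.divides q refl) with valuation N {q} (λ pᴺ∣q → ¬p∣x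
          (subst (p * p ^ N ∣ℕ_) (ℕₚ.*-comm p q) (ℕ∣.*-monoʳ-∣ p pᴺ∣q)))
  ...   | u , y , refl , p∤y = suc u , y , trans (ℕₚ.*-comm (p ^ u * y) p) (sym (ℕₚ.*-assoc p (p ^ u) y)) , p∤y

  valuation-unique : ∀ {u w x y} → p ∤ℕ x → p ∤ℕ y → p ^ u * x ≡ p ^ w * y → u ≡ w
  valuation-unique {u} {w} {x} {y} p∤x p∤y eq = ℕₚ.≤-antisym
    (^∣^*⇒≤ p∤y (subst (p ^ u ∣ℕ_) eq (ℕ∣.m∣m*n x)))
    (^∣^*⇒≤ p∤x (subst (p ^ w ∣ℕ_) (sym eq) (ℕ∣.m∣m*n y)))

  -- Newton polygon weights and Gauss's lemma

  module _ (k ℓ : ℕ) (1≤ℓ : 1 ≤ ℓ) where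

    -- The weight ℓ · vₚ(x) + k · i of the term x wⁱ is at least A.
    record Weight≥ (A i : ℕ) (x : ℤ) : Set where
      constructor weight
      field
        exponent : ℕ
        bound    : A ≤ ℓ * exponent + k * i
        divisor  : p ^ exponent ∣ℕ ∣ x ∣

    -- As ℓ is at least 1, exponent `A` always suffices for weight `A`. This bounds the search in
    -- `Weight≥?` and gives 0 every weight without an infinite valuation.
    A≤weight : ∀ A i → A ≤ ℓ * A + k * i
    A≤weight A i = ℕₚ.≤-trans (ℕₚ.m≤n*m A ℓ {{ℕ.>-nonZero 1≤ℓ}}) (ℕₚ.m≤m+n _ _)

    Weight≥? : ∀ A i → Decidable (Weight≥ A i)
    Weight≥? A i x = map′ (λ { (e , _ , A≤ , e∣x) → weight e A≤ e∣x }) capped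
      (ℕₚ.anyUpTo? (λ e → (A ℕₚ.≤? ℓ * e + k * i) ×-dec (p ^ e ℕ∣.∣? ∣ x ∣)) (suc A))
      where
      capped : Weight≥ A i x → ∃ λ e → e < suc A × A ≤ ℓ * e + k * i × p ^ e ∣ℕ ∣ x ∣
      capped (weight e A≤ pᵉ∣x) with ℕₚ.≤-total e A
      ... | inj₁ e≤A = e , s≤s e≤A , A≤ , pᵉ∣x
      ... | inj₂ A≤e = A , ℕₚ.≤-refl , A≤weight A i , ℕ∣.∣-trans (^-∣ p A≤e) pᵉ∣x

    Weight≥-0 : ∀ {A i} → Weight≥ A i 0ℤ
    Weight≥-0 {A} {i} = weight A (A≤weight A i) (_ ℕ∣.∣0)

    Weight≥-+ : ∀ {A i x y} → Weight≥ A i x → Weight≥ A i y → Weight≥ A i (x ℤ.+ y)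
    Weight≥-+ {x = x} {y} (weight e A≤e e∣x) (weight e′ A≤e′ e′∣y) with ℕₚ.≤-total e e′
    ... | inj₁ e≤e′ = weight e  A≤e  (∣ℤ-+ x y e∣x (ℕ∣.∣-trans (^-∣ p e≤e′) e′∣y))
    ... | inj₂ e′≤e = weight e′ A≤e′ (∣ℤ-+ x y (ℕ∣.∣-trans (^-∣ p e′≤e) e∣x) e′∣y)

    Weight≥-neg : ∀ {A i x} → Weight≥ A i x → Weight≥ A i (- x)
    Weight≥-neg {x = x} (weight e A≤ e∣x) = weight e A≤ (subst (p ^ e ∣ℕ_) (sym (ℤₚ.∣-i∣≡∣i∣ x)) e∣x)

    Weight≥-* : ∀ {A B i j x y} → Weight≥ A i x → Weight≥ B j y → Weight≥ (A + B) (i + j) (x ℤ.* y)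
    Weight≥-* {i = i} {j} {x} {y} (weight e A≤ e∣x) (weight e′ B≤ e′∣y) = weight (e + e′)
      (ℕₚ.≤-trans (ℕₚ.+-mono-≤ A≤ B≤) (ℕₚ.≤-reflexive (ring ℓ k e e′ i j)))
      (subst₂ _∣ℕ_ (sym (ℕₚ.^-distribˡ-+-* p e e′)) (sym (ℤₚ.abs-* x y)) (ℕ∣.*-pres-∣ e∣x e′∣y))
      where
      ring : ∀ ℓ k e e′ i j → ℓ * e + k * i + (ℓ * e′ + k * j) ≡ ℓ * (e + e′) + k * (i + j)
      ring = ℕ-Solver.solve-∀

    -- If p divided the cofactor y, the exponent e + 1 would be available and, since ℓ is at least
    -- 1, would raise the weight beyond `A`.
    Weight≥-exact : ∀ {A i x} → Weight≥ A i x → ¬ Weight≥ (suc A) i x →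
                    ∃₂ λ e y → ∣ x ∣ ≡ p ^ e * y × p ∤ℕ y × A ≡ ℓ * e + k * i
    Weight≥-exact {A} {i} {x} (weight e A≤ (ℕ∣.divides y eq)) ¬W = e , y , ∣x∣≡ , p∤y , A≡
      where
      A≡ : A ≡ ℓ * e + k * i
      A≡ = ℕₚ.≤-antisym A≤ (ℕₚ.≮⇒≥ λ A< → ¬W (weight e A< (ℕ∣.divides y eq)))
      ∣x∣≡ : ∣ x ∣ ≡ p ^ e * y
      ∣x∣≡ = trans eq (ℕₚ.*-comm y (p ^ e))
      A<next : A < ℓ * suc e + k * i
      A<next = ℕₚ.≤-<-trans A≤ (ℕₚ.+-monoˡ-< (k * i) (ℕₚ.*-monoʳ-< ℓ {{ℕ.>-nonZero 1≤ℓ}} (ℕₚ.n<1+n e)))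
      p∤y : p ∤ℕ y
      p∤y p∣y = ¬W (weight (suc e) A<next
        (subst₂ _∣ℕ_ (ℕₚ.*-comm (p ^ e) p) (sym ∣x∣≡) (ℕ∣.*-monoʳ-∣ (p ^ e) p∣y)))

    Weight≥-exact-bound : ∀ {A i x e y} → ∣ x ∣ ≡ p ^ e * y → p ∤ℕ y →
                          Weight≥ A i x → A ≤ ℓ * e + k * i
    Weight≥-exact-bound {i = i} {e = e} eq p∤y (weight e′ A≤ e′∣x) = ℕₚ.≤-trans A≤
      (ℕₚ.+-monoˡ-≤ (k * i) (ℕₚ.*-monoʳ-≤ ℓ (^∣^*⇒≤ {e = e′} {u = e} p∤y (subst (p ^ e′ ∣ℕ_) eq e′∣x))))

    -- The search stops at `A` because a zero sequence has no least weight. Recording the first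
    -- index that attains the minimum singles out one leading term for `gauss`.
    least-weight : ∀ (S : Seq) N → (∀ i → N ≤ i → S i ≡ 0ℤ) → ∀ A →
      (∀ i → Weight≥ A i (S i)) ⊎
      ∃ λ B → B < A × (∀ i → Weight≥ B i (S i)) ×
        ∃ λ i₀ → ¬ Weight≥ (suc B) i₀ (S i₀) × (∀ i → i < i₀ → Weight≥ (suc B) i (S i))
    least-weight S N end zero = inj₁ λ i → weight 0 z≤n (ℕ∣.1∣ _)
    least-weight S N end (suc A) with least-weight S N end A
    ... | inj₂ (B , B<A , rest) = inj₂ (B , ℕₚ.m<n⇒m<1+n B<A , rest)
    ... | inj₁ all with first-failure (λ i → Weight≥? (suc A) i (S i)) N
    ...   | inj₂ failure = inj₂ (A , ℕₚ.n<1+n A , all , failure)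
    ...   | inj₁ below = inj₁ λ i → [ below i
            , (λ N≤i → subst (Weight≥ (suc A) i) (sym (end i N≤i)) (Weight≥-0 {suc A} {i})) ]′ (ℕₚ.<-≤-connex i N)

    -- Gauss's lemma: least weights add up under multiplication.
    gauss : ∀ {S R : Seq} {M N C A B} → (∀ i → M ≤ i → S i ≡ 0ℤ) → (∀ i → N ≤ i → R i ≡ 0ℤ) →
      (∀ i → Weight≥ C i ((S ⋆ R) i)) → A + B ≡ suc C →
      (∀ i → Weight≥ A i (S i)) ⊎ (∀ i → Weight≥ B i (R i))
    gauss {S} {R} {M} {N} {C} {A} {B} endS endR all⋆ A+B≡
      with least-weight S M endS A | least-weight R N endR B
    ... | inj₁ allS | _         = inj₁ allS
    ... | inj₂ _    | inj₁ allR = inj₂ allR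
    ... | inj₂ (A′ , A′<A , allS , i₀ , ¬i₀ , belowS) | inj₂ (B′ , B′<B , allR , j₀ , ¬j₀ , belowR)
      with e  , x , ∣S∣≡ , p∤x , A′≡ ← Weight≥-exact (allS i₀) ¬i₀
         | e′ , y , ∣R∣≡ , p∤y , B′≡ ← Weight≥-exact (allR j₀) ¬j₀
      = contradiction (Weight≥-exact-bound {x = S i₀ ℤ.* R j₀} product (∤-* p∤x p∤y) leading)
          (ℕₚ.<⇒≱ (ℕₚ.≤-reflexive (cong suc (sym weight≡))))
      where
      open ≡-Reasoning
      -- Any other pair with the same sum has i < i₀ or j < j₀, and before the first minimum the
      -- weight is larger by at least 1.
      others : ∀ i j → i + j ≡ i₀ + j₀ → i ≢ i₀ → Weight≥ (suc (A′ + B′)) (i₀ + j₀) (S i ℤ.* R j)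
      others i j i+j≡ i≢i₀ with ℕₚ.<-≤-connex i i₀
      ... | inj₁ i<i₀ = subst (λ s → Weight≥ (suc (A′ + B′)) s (S i ℤ.* R j)) i+j≡
              (Weight≥-* {suc A′} {B′} {i} {j} {S i} {R j} (belowS i i<i₀) (allR j))
      ... | inj₂ i₀≤i = subst₂ (λ a s → Weight≥ a s (S i ℤ.* R j)) (ℕₚ.+-suc A′ B′) i+j≡
              (Weight≥-* {A′} {suc B′} {i} {j} {S i} {R j} (allS i) (belowR j (ℕₚ.≰⇒> λ j₀≤j →
                ℕₚ.<-irrefl (sym i+j≡) (ℕₚ.+-mono-<-≤ (ℕₚ.≤∧≢⇒< i₀≤i (λ e → i≢i₀ (sym e))) j₀≤j))))
      split : ∃ λ z → (S ⋆ R) (i₀ + j₀) ≡ S i₀ ℤ.* R j₀ ℤ.+ z × Weight≥ (suc (A′ + B′)) (i₀ + j₀) z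
      split = ⋆-split (Weight≥-0 {suc (A′ + B′)} {i₀ + j₀}) (λ {x} {y} → Weight≥-+ {x = x} {y})
        S R i₀ j₀ others
      rest : ℤ
      rest = proj₁ split
      -- Both inequalities A′ < A and B′ < B are strict, so A + B = C + 1 still leaves one unit. The
      -- leading product would then have weight above A′ + B′, its exact weight.
      C≥ : suc (A′ + B′) ≤ C
      C≥ = ℕₚ.≤-pred (subst₂ _≤_ (cong suc (ℕₚ.+-suc A′ B′)) A+B≡ (ℕₚ.+-mono-≤ A′<A B′<B))
      ring : ∀ a b → a ℤ.+ b ℤ.+ - b ≡ a
      ring = solve-∀
      leading : Weight≥ (suc (A′ + B′)) (i₀ + j₀) (S i₀ ℤ.* R j₀)
      leading with all⋆ (i₀ + j₀)
      ... | weight e″ C≤ e″∣ = subst (Weight≥ (suc (A′ + B′)) (i₀ + j₀))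
              (trans (cong (λ z → z ℤ.+ - rest) (proj₁ (proj₂ split))) (ring (S i₀ ℤ.* R j₀) rest))
              (Weight≥-+ {x = (S ⋆ R) (i₀ + j₀)} { - rest} (weight e″ (ℕₚ.≤-trans C≥ C≤) e″∣) (Weight≥-neg {x = rest} (proj₂ (proj₂ split))))
      product : ∣ S i₀ ℤ.* R j₀ ∣ ≡ p ^ (e + e′) * (x * y)
      product = begin
        ∣ S i₀ ℤ.* R j₀ ∣            ≡⟨ ℤₚ.abs-* (S i₀) (R j₀) ⟩
        ∣ S i₀ ∣ * ∣ R j₀ ∣          ≡⟨ cong₂ _*_ ∣S∣≡ ∣R∣≡ ⟩
        p ^ e * x * (p ^ e′ * y)     ≡⟨ swap (p ^ e) x (p ^ e′) y ⟩
        p ^ e * p ^ e′ * (x * y)     ≡⟨ cong (_* (x * y)) (ℕₚ.^-distribˡ-+-* p e e′) ⟨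
        p ^ (e + e′) * (x * y)       ∎
        where
        swap : ∀ a b c d → a * b * (c * d) ≡ a * c * (b * d)
        swap = ℕ-Solver.solve-∀
      weight≡ : A′ + B′ ≡ ℓ * (e + e′) + k * (i₀ + j₀)
      weight≡ = trans (cong₂ _+_ A′≡ B′≡) (collect ℓ k e e′ i₀ j₀)
        where
        collect : ∀ ℓ k e e′ i j → ℓ * e + k * i + (ℓ * e′ + k * j) ≡ ℓ * (e + e′) + k * (i + j)
        collect = ℕ-Solver.solve-∀

  -- The Newton polygon of S ⋆ R has an edge from (0 , k) to (ℓ , 0), which
  -- contains no further lattice point, so it cannot be split between S and R.
  newton : ∀ {k ℓ} → gcd k ℓ ≡ 1 → 1 ≤ ℓ → ∀ {S R : Seq} {M N} →
    (∀ i → M ≤ i → S i ≡ 0ℤ) → (∀ i → N ≤ i → R i ≡ 0ℤ) →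
    (∀ i → i < ℓ → p ^ k ∣ℕ ∣ (S ⋆ R) i ∣) → p ∤ℕ ∣ (S ⋆ R) ℓ ∣ →
    ∀ {u w x y} → ∣ S 0 ∣ ≡ p ^ u * x → p ∤ℕ x → ∣ R 0 ∣ ≡ p ^ w * y → p ∤ℕ y → u + w ≡ k →
    1 ≤ u → 1 ≤ w → ⊥
  newton {k} {ℓ} coprime 1≤ℓ {S} {R} endS endR low p∤ℓ {u} {w} {x} {y} S₀≡ p∤x R₀≡ p∤y u+w≡k 1≤u 1≤w
    -- The endpoint (ℓ , 0) of the edge must come from points (i , 0) and (j , 0) of the two
    -- factors. Since p divides both constant terms, neither index is 0.
    with i , j , i+j≡ℓ , p∤SᵢRⱼ ← ⋆-witness {λ z → p ∣ℕ ∣ z ∣} (p ℕ∣.∣0) (λ {x} {y} → ∣ℤ-+ x y)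
           (λ z → p ℕ∣.∣? ∣ z ∣) S R ℓ p∤ℓ
    = ℕₚ.<⇒≱ i<ℓ (ℕ∣.∣⇒≤ {{ℕ.>-nonZero 1≤i}} ℓ∣i)
    where
    open ℕₚ.≤-Reasoning
    p∤Sᵢ : p ∤ℕ ∣ S i ∣
    p∤Sᵢ p∣ = p∤SᵢRⱼ (subst (p ∣ℕ_) (sym (ℤₚ.abs-* (S i) (R j))) (ℕ∣.∣m⇒∣m*n ∣ R j ∣ p∣))
    p∤Rⱼ : p ∤ℕ ∣ R j ∣
    p∤Rⱼ p∣ = p∤SᵢRⱼ (subst (p ∣ℕ_) (sym (ℤₚ.abs-* (S i) (R j))) (ℕ∣.∣n⇒∣m*n ∣ S i ∣ p∣))
    positive : ∀ (T : Seq) {e z} → ∣ T 0 ∣ ≡ p ^ e * z → 1 ≤ e → ∀ {i} → p ∤ℕ ∣ T i ∣ → 1 ≤ i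
    positive T {suc e} {z} T₀≡ _ {zero}  p∤ = contradiction
      (subst (p ∣ℕ_) (sym (trans T₀≡ (ℕₚ.*-assoc p (p ^ e) z))) (ℕ∣.m∣m*n (p ^ e * z))) p∤
    positive T               _   _ {suc i} _  = s≤s z≤n
    1≤i : 1 ≤ i
    1≤i = positive S S₀≡ 1≤u p∤Sᵢ
    i<ℓ : i < ℓ
    i<ℓ = subst (i <_) i+j≡ℓ (ℕₚ.m<m+n i (positive R R₀≡ 1≤w p∤Rⱼ))
    -- No coefficient lies below the line through (0 , k) and (ℓ , 0): for i < ℓ this is
    -- divisibility by p^k, and from ℓ on k i alone reaches ℓ k.
    all⋆ : ∀ i → Weight≥ k ℓ 1≤ℓ (ℓ * k) i ((S ⋆ R) i)
    all⋆ i with ℕₚ.<-≤-connex i ℓ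
    ... | inj₁ i<ℓ = weight k (ℕₚ.m≤m+n (ℓ * k) (k * i)) (low i i<ℓ)
    ... | inj₂ ℓ≤i = weight 0 (ℕₚ.≤-trans (ℕₚ.≤-reflexive (ℕₚ.*-comm ℓ k))
                           (ℕₚ.≤-trans (ℕₚ.*-monoʳ-≤ k ℓ≤i) (ℕₚ.m≤n+m (k * i) (ℓ * 0)))) (ℕ∣.1∣ _)
    ℓu+ℓw≡ : ℓ * u + ℓ * w ≡ ℓ * k
    ℓu+ℓw≡ = trans (sym (ℕₚ.*-distribˡ-+ ℓ u w)) (cong (ℓ *_) u+w≡k)
    not-all : ∀ (T : Seq) {e z} → ∣ T 0 ∣ ≡ p ^ e * z → p ∤ℕ z →
              ¬ (∀ i → Weight≥ k ℓ 1≤ℓ (suc (ℓ * e)) i (T i))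
    not-all T {e} T₀≡ p∤z all = ℕₚ.<⇒≱ (ℕₚ.n<1+n (ℓ * e)) (ℕₚ.≤-trans
      (Weight≥-exact-bound k ℓ 1≤ℓ {x = T 0} T₀≡ p∤z (all 0))
      (ℕₚ.≤-reflexive (trans (cong (λ y → ℓ * e + y) (ℕₚ.*-zeroʳ k)) (ℕₚ.+-identityʳ _))))
    at-unit : ∀ (T : Seq) {e i} → (∀ i → Weight≥ k ℓ 1≤ℓ (ℓ * e) i (T i)) → p ∤ℕ ∣ T i ∣ → ℓ * e ≤ k * i
    at-unit T {e} {i} all p∤ = ℕₚ.≤-trans
      (Weight≥-exact-bound k ℓ 1≤ℓ {x = T i} {0} (sym (ℕₚ.*-identityˡ ∣ T i ∣)) p∤ (all i))
      (ℕₚ.≤-reflexive (cong (_+ k * i) (ℕₚ.*-zeroʳ ℓ)))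
    -- Gauss's lemma is applied to ℓ k + 1 = ℓ u + (ℓ w + 1). The term `R 0` has weight exactly ℓ w,
    -- so the extra unit rules out `R` and the bound falls on `S`. The next estimate puts the unit
    -- on the other side.
    ℓu≤ki : ℓ * u ≤ k * i
    ℓu≤ki with gauss k ℓ 1≤ℓ endS endR all⋆ (trans (ℕₚ.+-suc (ℓ * u) (ℓ * w)) (cong suc ℓu+ℓw≡))
    ... | inj₁ allS = at-unit S {u} allS p∤Sᵢ
    ... | inj₂ allR = contradiction allR (not-all R R₀≡ p∤y)
    ℓw≤kj : ℓ * w ≤ k * j
    ℓw≤kj with gauss k ℓ 1≤ℓ endS endR all⋆ (cong suc ℓu+ℓw≡)
    ... | inj₁ allS = contradiction allS (not-all S S₀≡ p∤x)
    ... | inj₂ allR = at-unit R {w} allR p∤Rⱼ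
    ki≤ℓu : k * i ≤ ℓ * u
    ki≤ℓu = ℕₚ.+-cancelʳ-≤ (k * j) _ _ (begin
      k * i + k * j     ≡⟨ ℕₚ.*-distribˡ-+ k i j ⟨
      k * (i + j)       ≡⟨ cong (k *_) i+j≡ℓ ⟩
      k * ℓ             ≡⟨ ℕₚ.*-comm k ℓ ⟩
      ℓ * k             ≡⟨ ℓu+ℓw≡ ⟨
      ℓ * u + ℓ * w     ≤⟨ ℕₚ.+-monoʳ-≤ (ℓ * u) ℓw≤kj ⟩
      ℓ * u + k * j     ∎)
    -- The two estimates add up to k ℓ on both sides, so each is an equality; ℓ u = k i with k prime
    -- to ℓ contradicts 0 < i < ℓ.
    ℓ∣i : ℓ ∣ℕ i
    ℓ∣i = Coprime.coprime-divisor (Coprime.sym (Coprime.gcd≡1⇒coprime {k} {ℓ} coprime))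
      (subst (ℓ ∣ℕ_) (ℕₚ.≤-antisym ℓu≤ki ki≤ℓu) (ℕ∣.m∣m*n u))

-- Natural numbers among the rationals, and rational inequalities

ι : ℕ → ℚ
ι k = + k ℚ./ 1

-- For a variable `k`, the normalisation inside `ι k` is stuck on a gcd; the explicit fraction lets
-- sums, products and comparisons compute.
ι-mkℚ : ∀ k → ι k ≡ mkℚ (+ k) 0 (Coprime.sym (Coprime.1-coprimeTo k))
ι-mkℚ k = ℚₚ.normalize-coprime (Coprime.sym (Coprime.1-coprimeTo k))

ι-+ : ∀ k l → ι (k + l) ≡ ι k ℚ.+ ι l
ι-+ k l = trans (cong (ℚ._/ 1) (cong₂ ℤ._+_ (sym (ℤₚ.*-identityʳ (+ k))) (sym (ℤₚ.*-identityʳ (+ l)))))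
  (sym (cong₂ ℚ._+_ (ι-mkℚ k) (ι-mkℚ l)))

ι-* : ∀ k l → ι (k * l) ≡ ι k ℚ.* ι l
ι-* k l = trans (cong (ℚ._/ 1) (ℤₚ.pos-* k l)) (sym (cong₂ ℚ._*_ (ι-mkℚ k) (ι-mkℚ l)))

ι-^ : ∀ k l → ι (k ^ l) ≡ ι k ^ℚ l
ι-^ k zero    = refl
ι-^ k (suc l) = trans (ι-* k (k ^ l)) (cong (ι k ℚ.*_) (ι-^ k l))

ι-sum : ∀ {k} (t : Vector ℕ k) → ι (sum t) ≡ sumℚ (λ i → ι (t i))
ι-sum {zero}  t = refl
ι-sum {suc k} t = trans (ι-+ (t zero) _) (cong (λ y → ι (t zero) ℚ.+ y) (ι-sum (λ i → t (suc i))))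

ι-mono-≤ : ∀ {k l} → k ≤ l → ι k ℚ.≤ ι l
ι-mono-≤ {k} {l} k≤l = subst₂ ℚ._≤_ (sym (ι-mkℚ k)) (sym (ι-mkℚ l))
  (ℚ.*≤* (subst₂ ℤ._≤_ (sym (ℤₚ.*-identityʳ (+ k))) (sym (ℤₚ.*-identityʳ (+ l))) (ℤ.+≤+ k≤l)))

ι-cancel-< : ∀ {k l} → ι k ℚ.< ι l → k < l
ι-cancel-< {k} {l} k<l = ℕₚ.≰⇒> λ l≤k → ℚₚ.<-irrefl refl (ℚₚ.<-≤-trans k<l (ι-mono-≤ l≤k))

0≤ι : ∀ k → 0ℚ ℚ.≤ ι k
0≤ι k = ι-mono-≤ {0} {k} z≤n

*-monoʳ-≤ : ∀ {r p q} → 0ℚ ℚ.≤ r → p ℚ.≤ q → r ℚ.* p ℚ.≤ r ℚ.* q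
*-monoʳ-≤ {r} 0≤r = ℚₚ.*-monoˡ-≤-nonNeg r {{ℚ.nonNegative 0≤r}}

*-mono-≤ : ∀ {p q r s} → 0ℚ ℚ.≤ p → 0ℚ ℚ.≤ s → p ℚ.≤ q → r ℚ.≤ s → p ℚ.* r ℚ.≤ q ℚ.* s
*-mono-≤ {s = s} 0≤p 0≤s p≤q r≤s = ℚₚ.≤-trans (*-monoʳ-≤ 0≤p r≤s)
  (ℚₚ.*-monoʳ-≤-nonNeg s {{ℚ.nonNegative 0≤s}} p≤q)

0≤* : ∀ {p q} → 0ℚ ℚ.≤ p → 0ℚ ℚ.≤ q → 0ℚ ℚ.≤ p ℚ.* q
0≤* {p} {q} 0≤p 0≤q = subst (ℚ._≤ p ℚ.* q) (ℚₚ.*-zeroʳ p) (*-monoʳ-≤ 0≤p 0≤q)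

0<* : ∀ {p q} → 0ℚ ℚ.< p → 0ℚ ℚ.< q → 0ℚ ℚ.< p ℚ.* q
0<* {p} {q} 0<p 0<q = subst (ℚ._< p ℚ.* q) (ℚₚ.*-zeroʳ p) (ℚₚ.*-monoʳ-<-pos p {{ℚ.positive 0<p}} 0<q)

0≤^ : ∀ {x} k → 0ℚ ℚ.≤ x → 0ℚ ℚ.≤ x ^ℚ k
0≤^ zero    0≤x = ι-mono-≤ {0} {1} z≤n
0≤^ (suc k) 0≤x = 0≤* 0≤x (0≤^ k 0≤x)

0<^ : ∀ {x} k → 0ℚ ℚ.< x → 0ℚ ℚ.< x ^ℚ k
0<^ zero    0<x = ℚₚ.positive⁻¹ 1ℚ
0<^ (suc k) 0<x = 0<* 0<x (0<^ k 0<x)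

^ℚ-monoˡ-≤ : ∀ {x y} k → 0ℚ ℚ.≤ x → x ℚ.≤ y → x ^ℚ k ℚ.≤ y ^ℚ k
^ℚ-monoˡ-≤ zero    0≤x x≤y = ℚₚ.≤-refl
^ℚ-monoˡ-≤ (suc k) 0≤x x≤y = *-mono-≤ 0≤x (0≤^ k (ℚₚ.≤-trans 0≤x x≤y)) x≤y (^ℚ-monoˡ-≤ k 0≤x x≤y)

1≤⇒0≤ : ∀ {x} → 1ℚ ℚ.≤ x → 0ℚ ℚ.≤ x
1≤⇒0≤ = ℚₚ.≤-trans (ι-mono-≤ {0} {1} z≤n)

^ℚ-monoʳ-≤ : ∀ {x k l} → 1ℚ ℚ.≤ x → k ≤ l → x ^ℚ k ℚ.≤ x ^ℚ l
^ℚ-monoʳ-≤ {x} {l = zero}  1≤x z≤n = ℚₚ.≤-refl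
^ℚ-monoʳ-≤ {x} {l = suc l} 1≤x z≤n = subst (ℚ._≤ x ℚ.* x ^ℚ l) (ℚₚ.*-identityˡ 1ℚ)
  (*-mono-≤ (1≤⇒0≤ ℚₚ.≤-refl) (0≤^ l (1≤⇒0≤ 1≤x)) 1≤x (^ℚ-monoʳ-≤ {l = l} 1≤x z≤n))
^ℚ-monoʳ-≤ 1≤x (s≤s k≤l) = *-monoʳ-≤ (1≤⇒0≤ 1≤x) (^ℚ-monoʳ-≤ 1≤x k≤l)

sumℚ-mono : ∀ {k} (s t : Vector ℚ k) → (∀ i → s i ℚ.≤ t i) → sumℚ s ℚ.≤ sumℚ t
sumℚ-mono {zero}  s t s≤t = ℚₚ.≤-refl
sumℚ-mono {suc k} s t s≤t = ℚₚ.+-mono-≤ (s≤t zero) (sumℚ-mono _ _ (λ i → s≤t (suc i)))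

sumℚ-*ˡ : ∀ {k} x (t : Vector ℚ k) → sumℚ (λ i → x ℚ.* t i) ≡ x ℚ.* sumℚ t
sumℚ-*ˡ {zero}  x t = sym (ℚₚ.*-zeroʳ x)
sumℚ-*ˡ {suc k} x t = trans (cong (λ y → x ℚ.* t zero ℚ.+ y) (sumℚ-*ˡ x (λ i → t (suc i))))
  (sym (ℚₚ.*-distribˡ-+ x (t zero) _))

-- Real numbers through their approximations

seq-^ : ∀ x k i → seq (x ^ᴿ k) i ≡ seq x i ^ℚ k
seq-^ x zero    i = refl
seq-^ x (suc k) i = cong (seq x i ℚ.*_) (seq-^ x k i)

seq-sum : ∀ {k} (t : Vector ℝ k) i → seq (sumᴿ t) i ≡ sumℚ (λ l → seq (t l) i)
seq-sum {zero}  t i = refl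
seq-sum {suc k} t i = cong (λ y → seq (t zero) i ℚ.+ y) (seq-sum (λ l → t (suc l)) i)

p≤∣p∣ : ∀ p → p ℚ.≤ ℚ.∣ p ∣
p≤∣p∣ p with ℚₚ.≤-total 0ℚ p
... | inj₁ 0≤p = ℚₚ.≤-reflexive (sym (ℚₚ.0≤p⇒∣p∣≡p 0≤p))
... | inj₂ p≤0 = ℚₚ.≤-trans p≤0 (ℚₚ.0≤∣p∣ p)

close⇒< : ∀ p q {ε} → ℚ.∣ p ℚ.- q ∣ ℚ.< ε → p ℚ.< q ℚ.+ ε
close⇒< p q {ε} close = subst (ℚ._< q ℚ.+ ε) (solve 2 (λ p q → q :+ (p :- q) := p) refl p q)
  (ℚₚ.+-monoʳ-< q (ℚₚ.≤-<-trans (p≤∣p∣ (p ℚ.- q)) close))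

+-cancelʳ-< : ∀ r {p q} → p ℚ.+ r ℚ.< q ℚ.+ r → p ℚ.< q
+-cancelʳ-< r {p} {q} lt = subst₂ ℚ._<_ (drop p) (drop q) (ℚₚ.+-monoˡ-< (ℚ.- r) lt)
  where
  drop : ∀ p → p ℚ.+ r ℚ.+ ℚ.- r ≡ p
  drop p = solve 2 (λ p r → p :+ r :- r := p) refl p r

-- `x ≤ᴿ y` is only a negation. The positive statement comes from deciding one comparison of
-- rationals at `N`, with the Cauchy property carrying either answer to all later indices; a
-- negative answer would prove `y <ᴿ x`.
≤ᴿ⇒eventually : ∀ x y → x ≤ᴿ y → ∀ ε → 0ℚ ℚ.< ε →
                ∃ λ N → ∀ i → N ≤ i → seq x i ℚ.≤ seq y i ℚ.+ ε
≤ᴿ⇒eventually x y x≤y ε 0<ε = N , decide (seq x N ℚₚ.≤? seq y N ℚ.+ (+ 3 ℚ./ 5) ℚ.* ε)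
  where
  open ℚₚ.≤-Reasoning
  -- The threshold of three fifths leaves two fifths for the drift of x and y in the positive case;
  -- in the negative case the two drifts use up two of the three and one remains as the gap.
  τ : ℚ
  τ = + 1 ℚ./ 5 ℚ.* ε
  0<τ : 0ℚ ℚ.< τ
  0<τ = 0<* (ℚₚ.positive⁻¹ (+ 1 ℚ./ 5)) 0<ε
  M M′ N : ℕ
  M  = proj₁ (cauchy x τ 0<τ)
  M′ = proj₁ (cauchy y τ 0<τ)
  N  = M ℕ.⊔ M′
  closeˣ : ∀ {i j} → N ≤ i → N ≤ j → seq x i ℚ.< seq x j ℚ.+ τ
  closeˣ {i} {j} N≤i N≤j = close⇒< (seq x i) (seq x j)
    (proj₂ (cauchy x τ 0<τ) i j (ℕₚ.m⊔n≤o⇒m≤o M M′ N≤i) (ℕₚ.m⊔n≤o⇒m≤o M M′ N≤j))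
  closeʸ : ∀ {i j} → N ≤ i → N ≤ j → seq y i ℚ.< seq y j ℚ.+ τ
  closeʸ {i} {j} N≤i N≤j = close⇒< (seq y i) (seq y j)
    (proj₂ (cauchy y τ 0<τ) i j (ℕₚ.m⊔n≤o⇒n≤o M M′ N≤i) (ℕₚ.m⊔n≤o⇒n≤o M M′ N≤j))
  decide : Dec (seq x N ℚ.≤ seq y N ℚ.+ (+ 3 ℚ./ 5) ℚ.* ε) →
           ∀ i → N ≤ i → seq x i ℚ.≤ seq y i ℚ.+ ε
  decide (yes x≤) i N≤i = begin
    seq x i                                    ≤⟨ ℚₚ.<⇒≤ (closeˣ N≤i ℕₚ.≤-refl) ⟩
    seq x N ℚ.+ τ                              ≤⟨ ℚₚ.+-monoˡ-≤ τ x≤ ⟩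
    seq y N ℚ.+ (+ 3 ℚ./ 5) ℚ.* ε ℚ.+ τ        ≤⟨ ℚₚ.+-monoˡ-≤ τ (ℚₚ.+-monoˡ-≤ ((+ 3 ℚ./ 5) ℚ.* ε) (ℚₚ.<⇒≤ (closeʸ ℕₚ.≤-refl N≤i))) ⟩
    seq y i ℚ.+ τ ℚ.+ (+ 3 ℚ./ 5) ℚ.* ε ℚ.+ τ
      ≡⟨ solve 2 (λ y e → y :+ con (+ 1 ℚ./ 5) :* e :+ con (+ 3 ℚ./ 5) :* e :+ con (+ 1 ℚ./ 5) :* e := y :+ e) refl (seq y i) ε ⟩
    seq y i ℚ.+ ε                              ∎
  decide (no x≰) = contradiction (τ , 0<τ , N , λ i N≤i → +-cancelʳ-< τ (begin-strict
    seq y i ℚ.+ τ ℚ.+ τ                        <⟨ ℚₚ.+-monoˡ-< τ (ℚₚ.+-monoˡ-< τ (closeʸ N≤i ℕₚ.≤-refl)) ⟩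
    seq y N ℚ.+ τ ℚ.+ τ ℚ.+ τ
      ≡⟨ solve 2 (λ y e → y :+ con (+ 1 ℚ./ 5) :* e :+ con (+ 1 ℚ./ 5) :* e :+ con (+ 1 ℚ./ 5) :* e := y :+ con (+ 3 ℚ./ 5) :* e) refl (seq y N) ε ⟩
    seq y N ℚ.+ (+ 3 ℚ./ 5) ℚ.* ε              <⟨ ℚₚ.≰⇒> x≰ ⟩
    seq x N                                    <⟨ closeˣ ℕₚ.≤-refl N≤i ⟩
    seq x i ℚ.+ τ                              ∎)) x≤y

-- This is (1 + ε)ᵐ ≤ 1 + (2ᵐ - 1) ε, which follows from convexity.
bernoulli : ∀ {ε} m → 0ℚ ℚ.≤ ε → ε ℚ.≤ 1ℚ → (1ℚ ℚ.+ ε) ^ℚ m ℚ.+ ε ℚ.≤ 1ℚ ℚ.+ ε ℚ.* ι (2 ^ m)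
bernoulli {ε} zero    0≤ε ε≤1 = ℚₚ.≤-reflexive (cong (λ y → 1ℚ ℚ.+ y) (sym (ℚₚ.*-identityʳ ε)))
bernoulli {ε} (suc m) 0≤ε ε≤1 = begin
  (1ℚ ℚ.+ ε) ℚ.* t ℚ.+ ε                 ≡⟨ solve 2 (λ e t → (con 1ℚ :+ e) :* t :+ e := (t :+ e) :+ e :* t) refl ε t ⟩
  (t ℚ.+ ε) ℚ.+ ε ℚ.* t                  ≤⟨ ℚₚ.+-mono-≤ (bernoulli m 0≤ε ε≤1) (*-monoʳ-≤ 0≤ε t≤) ⟩
  (1ℚ ℚ.+ ε ℚ.* u) ℚ.+ ε ℚ.* u           ≡⟨ solve 2 (λ e u → (con 1ℚ :+ e :* u) :+ e :* u := con 1ℚ :+ e :* (con (ι 2) :* u)) refl ε u ⟩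
  1ℚ ℚ.+ ε ℚ.* (ι 2 ℚ.* u)               ≡⟨ cong (λ y → 1ℚ ℚ.+ ε ℚ.* y) (ι-* 2 (2 ^ m)) ⟨
  1ℚ ℚ.+ ε ℚ.* ι (2 * 2 ^ m)             ∎
  where
  open ℚₚ.≤-Reasoning
  t u : ℚ
  t = (1ℚ ℚ.+ ε) ^ℚ m
  u = ι (2 ^ m)
  t≤ : t ℚ.≤ u
  t≤ = subst (t ℚ.≤_) (sym (ι-^ 2 m)) (^ℚ-monoˡ-≤ m
    (ℚₚ.≤-trans 0≤ε (subst (ℚ._≤ 1ℚ ℚ.+ ε) (ℚₚ.+-identityˡ ε) (ℚₚ.+-monoˡ-≤ ε (1≤⇒0≤ ℚₚ.≤-refl))))
    (ℚₚ.+-monoʳ-≤ 1ℚ ε≤1))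

-- Dominance at rational approximations

split-power : ∀ (z : ℚ) i j → z ^ℚ i ≡ z ^ℚ (i ⊓ j) ℚ.* z ^ℚ (i ∸ j)
split-power z i j = trans (cong (z ^ℚ_) (sym (trans (cong (λ l → l + (i ∸ j)) (ℕₚ.⊓-comm i j)) (ℕₚ.m⊓n+n∸m≡n j i))))
  (^-homo-* z (i ⊓ j) (i ∸ j))

module _ {x y : ℚ} (0<x : 0ℚ ℚ.< x) (x≤y : x ℚ.≤ y) where

  private
    0≤x : 0ℚ ℚ.≤ x
    0≤x = ℚₚ.<⇒≤ 0<x
    0≤y : 0ℚ ℚ.≤ y
    0≤y = ℚₚ.≤-trans 0≤x x≤y

  -- The left side is (y / x)^(i ∸ j) x^i. As y / x is at least 1, the exponent may be raised to m ∸
  -- j, which accounts for the factor (β / α)^(m - j) in the theorem.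
  mixed-power-≤ : ∀ {m i} j → i ≤ m → x ^ℚ (i ⊓ j) ℚ.* y ^ℚ (i ∸ j) ℚ.≤ (y ℚ.* inv x) ^ℚ (m ∸ j) ℚ.* x ^ℚ i
  mixed-power-≤ {m} {i} j i≤m = begin
    X ℚ.* y ^ℚ t                          ≡⟨ cong (λ w → X ℚ.* w ^ℚ t) zx≡y ⟨
    X ℚ.* (z ℚ.* x) ^ℚ t                  ≡⟨ cong (X ℚ.*_) (^-distrib-* z x t) ⟩
    X ℚ.* (z ^ℚ t ℚ.* x ^ℚ t)             ≤⟨ *-monoʳ-≤ (0≤^ (i ⊓ j) 0≤x) (ℚₚ.*-monoʳ-≤-nonNeg (x ^ℚ t) {{ℚ.nonNegative (0≤^ t 0≤x)}}
                                               (^ℚ-monoʳ-≤ 1≤z (ℕₚ.∸-monoˡ-≤ j i≤m))) ⟩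
    X ℚ.* (z ^ℚ (m ∸ j) ℚ.* x ^ℚ t)       ≡⟨ solve 3 (λ a b c → a :* (b :* c) := b :* (a :* c)) refl X (z ^ℚ (m ∸ j)) (x ^ℚ t) ⟩
    z ^ℚ (m ∸ j) ℚ.* (X ℚ.* x ^ℚ t)       ≡⟨ cong (z ^ℚ (m ∸ j) ℚ.*_) (split-power x i j) ⟨
    z ^ℚ (m ∸ j) ℚ.* x ^ℚ i               ∎
    where
    open ℚₚ.≤-Reasoning
    t : ℕ
    t = i ∸ j
    z X : ℚ
    z = y ℚ.* inv x
    X = x ^ℚ (i ⊓ j)
    zx≡y : z ℚ.* x ≡ y
    zx≡y = trans (ℚₚ.*-assoc y (inv x) x)
      (trans (cong (y ℚ.*_) (trans (ℚₚ.*-comm (inv x) x) (inv-inverse 0<x))) (ℚₚ.*-identityʳ y))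
    1≤z : 1ℚ ℚ.≤ z
    1≤z = subst (ℚ._≤ z) (inv-inverse 0<x)
      (ℚₚ.*-monoʳ-≤-nonNeg (inv x) {{ℚ.nonNegative (ℚₚ.<⇒≤ (inv-pos 0<x))}} x≤y)

  module _ {A B λ′ : ℚ} (0≤A : 0ℚ ℚ.≤ A) (0≤B : 0ℚ ℚ.≤ B) (1≤λ : 1ℚ ℚ.≤ λ′)
           (x≤λA : x ℚ.≤ λ′ ℚ.* A) (B≤λy : B ℚ.≤ λ′ ℚ.* y) where

    -- Relative to the j-th weight, replacing (x , y) by (A , B) multiplies the i-th one by (x /
    -- A)^(j ∸ i) (B / y)^(i ∸ j). One exponent is 0 and the other at most m, so at most m factors
    -- `λ′` are lost; denominators are cleared.
    mixed-power-compare : ∀ {m i j} → i ≤ m → j ≤ m →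
      A ^ℚ (i ⊓ j) ℚ.* B ^ℚ (i ∸ j) ℚ.* x ^ℚ j ℚ.≤ λ′ ^ℚ m ℚ.* A ^ℚ j ℚ.* (x ^ℚ (i ⊓ j) ℚ.* y ^ℚ (i ∸ j))
    mixed-power-compare {m} {i} {j} i≤m j≤m = begin
      a ℚ.* B ^ℚ t ℚ.* x ^ℚ j                  ≡⟨ cong (a ℚ.* B ^ℚ t ℚ.*_) (split′ x) ⟩
      a ℚ.* B ^ℚ t ℚ.* (b ℚ.* x ^ℚ s)          ≡⟨ solve 4 (λ a c b d → a :* c :* (b :* d) := (a :* b) :* (c :* d)) refl a (B ^ℚ t) b (x ^ℚ s) ⟩
      (a ℚ.* b) ℚ.* (B ^ℚ t ℚ.* x ^ℚ s)        ≤⟨ *-monoʳ-≤ 0≤ab (*-mono-≤ (0≤^ t 0≤B) (0≤^ s (0≤* 0≤λ 0≤A))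
                                                    (^ℚ-monoˡ-≤ t 0≤B B≤λy) (^ℚ-monoˡ-≤ s 0≤x x≤λA)) ⟩
      (a ℚ.* b) ℚ.* ((λ′ ℚ.* y) ^ℚ t ℚ.* (λ′ ℚ.* A) ^ℚ s)
        ≡⟨ cong₂ (λ v w → (a ℚ.* b) ℚ.* (v ℚ.* w)) (^-distrib-* λ′ y t) (^-distrib-* λ′ A s) ⟩
      (a ℚ.* b) ℚ.* ((λ′ ^ℚ t ℚ.* y ^ℚ t) ℚ.* (λ′ ^ℚ s ℚ.* A ^ℚ s))
        ≡⟨ solve 6 (λ a b l y k c → (a :* b) :* ((l :* y) :* (k :* c)) := (l :* k) :* ((a :* c) :* (b :* y))) refl
             a b (λ′ ^ℚ t) (y ^ℚ t) (λ′ ^ℚ s) (A ^ℚ s) ⟩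
      (λ′ ^ℚ t ℚ.* λ′ ^ℚ s) ℚ.* ((a ℚ.* A ^ℚ s) ℚ.* (b ℚ.* y ^ℚ t))
        ≡⟨ cong₂ (λ v w → v ℚ.* (w ℚ.* (b ℚ.* y ^ℚ t))) (^-homo-* λ′ t s) (split′ A) ⟨
      λ′ ^ℚ (t + s) ℚ.* (A ^ℚ j ℚ.* (b ℚ.* y ^ℚ t))
        ≤⟨ ℚₚ.*-monoʳ-≤-nonNeg _ {{ℚ.nonNegative (0≤* (0≤^ j 0≤A) (0≤* (0≤^ (i ⊓ j) 0≤x) (0≤^ t 0≤y)))}}
             (^ℚ-monoʳ-≤ 1≤λ t+s≤m) ⟩
      λ′ ^ℚ m ℚ.* (A ^ℚ j ℚ.* (b ℚ.* y ^ℚ t))  ≡⟨ ℚₚ.*-assoc (λ′ ^ℚ m) (A ^ℚ j) _ ⟨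
      λ′ ^ℚ m ℚ.* A ^ℚ j ℚ.* (b ℚ.* y ^ℚ t)    ∎
      where
      open ℚₚ.≤-Reasoning
      s t : ℕ
      s = j ∸ i
      t = i ∸ j
      a b : ℚ
      a = A ^ℚ (i ⊓ j)
      b = x ^ℚ (i ⊓ j)
      0≤λ : 0ℚ ℚ.≤ λ′
      0≤λ = 1≤⇒0≤ 1≤λ
      0≤ab : 0ℚ ℚ.≤ a ℚ.* b
      0≤ab = 0≤* (0≤^ (i ⊓ j) 0≤A) (0≤^ (i ⊓ j) 0≤x)
      split′ : ∀ z → z ^ℚ j ≡ z ^ℚ (i ⊓ j) ℚ.* z ^ℚ s
      split′ z = trans (split-power z j i) (cong (λ l → z ^ℚ l ℚ.* z ^ℚ s) (ℕₚ.⊓-comm j i))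
      t+s≤m : t + s ≤ m
      t+s≤m with ℕₚ.≤-total i j
      ... | inj₁ i≤j = subst (λ l → l + s ≤ m) (sym (ℕₚ.m≤n⇒m∸n≡0 i≤j)) (ℕₚ.≤-trans (ℕₚ.m∸n≤m j i) j≤m)
      ... | inj₂ j≤i = subst (λ l → t + l ≤ m) (sym (ℕₚ.m≤n⇒m∸n≡0 j≤i))
                         (subst (_≤ m) (sym (ℕₚ.+-identityʳ t)) (ℕₚ.≤-trans (ℕₚ.m∸n≤m i j) i≤m))

sumℚ-cong : ∀ {k} (s t : Vector ℚ k) → (∀ i → s i ≡ t i) → sumℚ s ≡ sumℚ t
sumℚ-cong {zero}  s t s≡t = refl
sumℚ-cong {suc k} s t s≡t = cong₂ ℚ._+_ (s≡t zero) (sumℚ-cong _ _ (λ i → s≡t (suc i)))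

0≤sumℚ : ∀ {k} (t : Vector ℚ k) → (∀ i → 0ℚ ℚ.≤ t i) → 0ℚ ℚ.≤ sumℚ t
0≤sumℚ {zero}  t 0≤t = ℚₚ.≤-refl
0≤sumℚ {suc k} t 0≤t = ℚₚ.+-mono-≤ (0≤t zero) (0≤sumℚ _ (λ i → 0≤t (suc i)))

p≤p+q : ∀ p {q} → 0ℚ ℚ.≤ q → p ℚ.≤ p ℚ.+ q
p≤p+q p 0≤q = subst (ℚ._≤ p ℚ.+ _) (ℚₚ.+-identityʳ p) (ℚₚ.+-monoʳ-≤ p 0≤q)

module _ {m : ℕ} (c : Fin (suc m) → ℕ) (j : Fin (suc m)) where

  private
    J : ℕ
    J = toℕ j

  -- With U = Σᵢ cᵢ x^(i ⊓ J) y^(i ∸ J) and V = cⱼ x^J the hypothesis yields U + η < V,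
  -- whereas failure of the claim yields V ≤ (1 + ε)ᵐ U.
  rational-dominant : ∀ {x y η ε A B} → 0ℚ ℚ.< x → x ℚ.≤ y → 1 ≤ A → 0ℚ ℚ.≤ η → 0ℚ ℚ.≤ ε → ε ℚ.≤ 1ℚ →
    x ℚ.≤ (1ℚ ℚ.+ ε) ℚ.* ι A → ι B ℚ.≤ (1ℚ ℚ.+ ε) ℚ.* y →
    ε ℚ.* ι (2 ^ m * (c j * (2 * A) ^ J)) ℚ.≤ η →
    (y ℚ.* inv x) ^ℚ (m ∸ J) ℚ.* sumℚ (removeAt (λ i → ι (c i) ℚ.* x ^ℚ toℕ i) j) ℚ.+ η ℚ.< ι (c j) ℚ.* x ^ℚ J →
    sum (removeAt (λ i → c i * (A ^ (toℕ i ⊓ J) * B ^ (toℕ i ∸ J))) j) < c j * A ^ J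
  rational-dominant {x} {y} {η} {ε} {A} {B} 0<x x≤y 1≤A 0≤η 0≤ε ε≤1 x≤λA B≤λy ε-small dom =
    ℕₚ.≰⇒> λ cA≤L → ℚₚ.<-irrefl refl (begin-strict
      V                            ≤⟨ V≤λU cA≤L ⟩
      l ^ℚ m ℚ.* U                 ≤⟨ ℚₚ.*-monoʳ-≤-nonNeg U {{ℚ.nonNegative 0≤U}} l^m≤ ⟩
      (1ℚ ℚ.+ ε ℚ.* ι (2 ^ m)) ℚ.* U
        ≡⟨ solve 3 (λ e t u → (con 1ℚ :+ e :* t) :* u := u :+ e :* (t :* u)) refl ε (ι (2 ^ m)) U ⟩
      U ℚ.+ ε ℚ.* (ι (2 ^ m) ℚ.* U)   ≤⟨ ℚₚ.+-monoʳ-≤ U (*-monoʳ-≤ 0≤ε (*-monoʳ-≤ (0≤ι (2 ^ m)) U≤K)) ⟩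
      U ℚ.+ ε ℚ.* (ι (2 ^ m) ℚ.* ι K) ≡⟨ cong (λ w → U ℚ.+ ε ℚ.* w) (ι-* (2 ^ m) K) ⟨
      U ℚ.+ ε ℚ.* ι (2 ^ m * K)       ≤⟨ ℚₚ.+-monoʳ-≤ U ε-small ⟩
      U ℚ.+ η                         <⟨ U+η<V ⟩
      V                               ∎)
    where
    open ℚₚ.≤-Reasoning
    -- `K` bounds V, hence U, through x ≤ (1 + ε) A ≤ 2 A. It is independent of x, so ε can be fixed
    -- before an index of the sequences is chosen.
    K : ℕ
    K = c j * (2 * A) ^ J
    l V : ℚ
    l = 1ℚ ℚ.+ ε
    V = ι (c j) ℚ.* x ^ℚ J
    w : ℚ → ℚ → ℕ → ℚ
    w u v i = u ^ℚ (i ⊓ J) ℚ.* v ^ℚ (i ∸ J)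
    0≤x : 0ℚ ℚ.≤ x
    0≤x = ℚₚ.<⇒≤ 0<x
    0≤y : 0ℚ ℚ.≤ y
    0≤y = ℚₚ.≤-trans 0≤x x≤y
    1≤l : 1ℚ ℚ.≤ l
    1≤l = p≤p+q 1ℚ 0≤ε
    wU : Fin (suc m) → ℚ
    wU i = ι (c i) ℚ.* w x y (toℕ i)
    U : ℚ
    U = sumℚ (removeAt wU j)
    0≤U : 0ℚ ℚ.≤ U
    0≤U = 0≤sumℚ (removeAt wU j) (λ i → 0≤* (0≤ι (c (punchIn j i)))
      (0≤* (0≤^ (toℕ (punchIn j i) ⊓ J) 0≤x) (0≤^ (toℕ (punchIn j i) ∸ J) 0≤y)))
    l^m≤ : l ^ℚ m ℚ.≤ 1ℚ ℚ.+ ε ℚ.* ι (2 ^ m)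
    l^m≤ = ℚₚ.≤-trans (p≤p+q (l ^ℚ m) 0≤ε) (bernoulli m 0≤ε ε≤1)
    Z : ℚ
    Z = (y ℚ.* inv x) ^ℚ (m ∸ J)
    U≤ : U ℚ.≤ Z ℚ.* sumℚ (removeAt (λ i → ι (c i) ℚ.* x ^ℚ toℕ i) j)
    U≤ = subst (U ℚ.≤_) (sumℚ-*ˡ Z (removeAt (λ i → ι (c i) ℚ.* x ^ℚ toℕ i) j))
      (sumℚ-mono (removeAt wU j) _ (λ i → each (punchIn j i)))
      where
      each : ∀ i → wU i ℚ.≤ Z ℚ.* (ι (c i) ℚ.* x ^ℚ toℕ i)
      each i = ℚₚ.≤-trans (*-monoʳ-≤ (0≤ι (c i)) (mixed-power-≤ 0<x x≤y J (toℕ≤pred[n] i)))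
        (ℚₚ.≤-reflexive (solve 3 (λ a b d → a :* (b :* d) := b :* (a :* d)) refl (ι (c i)) Z (x ^ℚ toℕ i)))
    U+η<V : U ℚ.+ η ℚ.< V
    U+η<V = ℚₚ.≤-<-trans (ℚₚ.+-monoˡ-≤ η U≤) dom
    U≤K : U ℚ.≤ ι K
    U≤K = begin
      U                            ≤⟨ ℚₚ.<⇒≤ (ℚₚ.≤-<-trans (p≤p+q U 0≤η) U+η<V) ⟩
      ι (c j) ℚ.* x ^ℚ J           ≤⟨ *-monoʳ-≤ (0≤ι (c j)) (^ℚ-monoˡ-≤ J 0≤x x≤2A) ⟩
      ι (c j) ℚ.* ι (2 * A) ^ℚ J   ≡⟨ cong (ι (c j) ℚ.*_) (ι-^ (2 * A) J) ⟨
      ι (c j) ℚ.* ι ((2 * A) ^ J)  ≡⟨ ι-* (c j) ((2 * A) ^ J) ⟨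
      ι K                          ∎
      where
      x≤2A : x ℚ.≤ ι (2 * A)
      x≤2A = ℚₚ.≤-trans x≤λA (subst (l ℚ.* ι A ℚ.≤_) (sym (ι-* 2 A))
        (ℚₚ.*-monoʳ-≤-nonNeg (ι A) {{ℚ.nonNegative (0≤ι A)}} (ℚₚ.+-monoʳ-≤ 1ℚ ε≤1)))
    wL : Fin (suc m) → ℕ
    wL i = c i * (A ^ (toℕ i ⊓ J) * B ^ (toℕ i ∸ J))
    ι-wL : ∀ i → ι (wL i) ≡ ι (c i) ℚ.* w (ι A) (ι B) (toℕ i)
    ι-wL i = trans (ι-* (c i) _) (cong (ι (c i) ℚ.*_) (trans (ι-* (A ^ (toℕ i ⊓ J)) (B ^ (toℕ i ∸ J)))
      (cong₂ ℚ._*_ (ι-^ A (toℕ i ⊓ J)) (ι-^ B (toℕ i ∸ J)))))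
    L≤ : x ^ℚ J ℚ.* ι (sum (removeAt wL j)) ℚ.≤ l ^ℚ m ℚ.* ι A ^ℚ J ℚ.* U
    L≤ = begin
      x ^ℚ J ℚ.* ι (sum (removeAt wL j))               ≡⟨ cong (x ^ℚ J ℚ.*_) (ι-sum (removeAt wL j)) ⟩
      x ^ℚ J ℚ.* sumℚ (λ i → ι (removeAt wL j i))      ≡⟨ sumℚ-*ˡ (x ^ℚ J) (λ i → ι (removeAt wL j i)) ⟨
      sumℚ (λ i → x ^ℚ J ℚ.* ι (removeAt wL j i))      ≤⟨ sumℚ-mono _ _ (λ i → each (punchIn j i)) ⟩
      sumℚ (λ i → l ^ℚ m ℚ.* ι A ^ℚ J ℚ.* removeAt wU j i) ≡⟨ sumℚ-*ˡ (l ^ℚ m ℚ.* ι A ^ℚ J) (removeAt wU j) ⟩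
      l ^ℚ m ℚ.* ι A ^ℚ J ℚ.* U                        ∎
      where
      each : ∀ i → x ^ℚ J ℚ.* ι (wL i) ℚ.≤ l ^ℚ m ℚ.* ι A ^ℚ J ℚ.* wU i
      each i = begin
        x ^ℚ J ℚ.* ι (wL i)                                        ≡⟨ cong (x ^ℚ J ℚ.*_) (ι-wL i) ⟩
        x ^ℚ J ℚ.* (ι (c i) ℚ.* w (ι A) (ι B) (toℕ i))
          ≡⟨ solve 3 (λ a b d → a :* (b :* d) := b :* (d :* a)) refl (x ^ℚ J) (ι (c i)) (w (ι A) (ι B) (toℕ i)) ⟩
        ι (c i) ℚ.* (w (ι A) (ι B) (toℕ i) ℚ.* x ^ℚ J)
          ≤⟨ *-monoʳ-≤ (0≤ι (c i)) (mixed-power-compare 0<x x≤y (0≤ι A) (0≤ι B) 1≤l x≤λA B≤λy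
               (toℕ≤pred[n] i) (toℕ≤pred[n] j)) ⟩
        ι (c i) ℚ.* (l ^ℚ m ℚ.* ι A ^ℚ J ℚ.* w x y (toℕ i))
          ≡⟨ solve 3 (λ a b d → a :* (b :* d) := b :* (a :* d)) refl (ι (c i)) (l ^ℚ m ℚ.* ι A ^ℚ J) (w x y (toℕ i)) ⟩
        l ^ℚ m ℚ.* ι A ^ℚ J ℚ.* wU i                               ∎
    0<A : 0ℚ ℚ.< ι A
    0<A = ℚₚ.<-≤-trans (ℚₚ.positive⁻¹ 1ℚ) (ι-mono-≤ {1} {A} 1≤A)
    V≤λU : c j * A ^ J ≤ sum (removeAt wL j) → V ℚ.≤ l ^ℚ m ℚ.* U
    V≤λU cA≤L = ℚₚ.*-cancelˡ-≤-pos (ι A ^ℚ J) {{ℚ.positive (0<^ J 0<A)}} (begin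
      ι A ^ℚ J ℚ.* (ι (c j) ℚ.* x ^ℚ J)
        ≡⟨ solve 3 (λ a b d → a :* (b :* d) := d :* (b :* a)) refl (ι A ^ℚ J) (ι (c j)) (x ^ℚ J) ⟩
      x ^ℚ J ℚ.* (ι (c j) ℚ.* ι A ^ℚ J)
        ≡⟨ cong (x ^ℚ J ℚ.*_) (trans (ι-* (c j) (A ^ J)) (cong (ι (c j) ℚ.*_) (ι-^ A J))) ⟨
      x ^ℚ J ℚ.* ι (c j * A ^ J)             ≤⟨ *-monoʳ-≤ (0≤^ J 0≤x) (ι-mono-≤ {c j * A ^ J} {sum (removeAt wL j)} cA≤L) ⟩
      x ^ℚ J ℚ.* ι (sum (removeAt wL j))     ≤⟨ L≤ ⟩
      l ^ℚ m ℚ.* ι A ^ℚ J ℚ.* U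
        ≡⟨ solve 3 (λ a b d → a :* b :* d := b :* (a :* d)) refl (l ^ℚ m) (ι A ^ℚ J) U ⟩
      ι A ^ℚ J ℚ.* (l ^ℚ m ℚ.* U)            ∎)

-- From the real hypothesis to the integral inequality

Eventually : (ℕ → Set) → Set
Eventually P = ∃ λ N → ∀ i → N ≤ i → P i

infixr 2 _⊗_
_⊗_ : ∀ {P Q} → Eventually P → Eventually Q → Eventually (λ i → P i × Q i)
(M , p) ⊗ (N , q) = M ℕ.⊔ N , λ i ≤i → p i (ℕₚ.m⊔n≤o⇒m≤o M N ≤i) , q i (ℕₚ.m⊔n≤o⇒n≤o M N ≤i)

pick : ∀ {P} → Eventually P → ∃ P
pick (N , p) = N , p N ℕₚ.≤-refl

+-cancelʳ-≤ : ∀ r {p q} → p ℚ.+ r ℚ.≤ q ℚ.+ r → p ℚ.≤ q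
+-cancelʳ-≤ r {p} {q} le = subst₂ ℚ._≤_ (drop p) (drop q) (ℚₚ.+-monoˡ-≤ (ℚ.- r) le)
  where
  drop : ∀ p → p ℚ.+ r ℚ.+ ℚ.- r ≡ p
  drop p = solve 2 (λ p r → p :+ r :- r := p) refl p r

positive-eventually : ∀ α ((η , _) : 0ᴿ <ᴿ α) → Eventually (λ i → η ℚ.< seq α i)
positive-eventually α (η , _ , N , η<α) = N , λ i N≤i → subst (ℚ._< seq α i) (ℚₚ.+-identityˡ η) (η<α i N≤i)

seq-fromℕ : ∀ n i → seq (fromℕ n) i ≡ ι n
seq-fromℕ n i = refl

seq-+ : ∀ x y i → seq (x +ᴿ y) i ≡ seq x i ℚ.+ seq y i
seq-+ x y i = refl

-- The tolerance is the positive lower bound η of α itself: it cancels against α > η and leaves the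
-- strict inequality d < n, so A = n - d is at least 1.
below-gap : ∀ α → 0ᴿ <ᴿ α → ∀ {n d} → α +ᴿ fromℕ d ≤ᴿ fromℕ n → ∃ λ A → n ≡ A + d × 1 ≤ A
below-gap α 0<α@(η , 0<η , _) {n} {d} α+d≤n = n ∸ d , sym (ℕₚ.m∸n+n≡m (ℕₚ.<⇒≤ d<n)) , ℕₚ.m<n⇒0<n∸m d<n
  where
  conclude : ∀ {x} → η ℚ.< x → x ℚ.+ ι d ℚ.≤ ι n ℚ.+ η → d < n
  conclude {x} η<x x≤ = ι-cancel-< {d} {n} (+-cancelʳ-< η {ι d} {ι n} (ℚₚ.<-≤-trans
    (subst (ι d ℚ.+ η ℚ.<_) (ℚₚ.+-comm (ι d) x) (ℚₚ.+-monoʳ-< (ι d) η<x)) x≤))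
  index : ∃ λ i → η ℚ.< seq α i × seq (α +ᴿ fromℕ d) i ℚ.≤ seq (fromℕ n) i ℚ.+ η
  index = pick {λ i → η ℚ.< seq α i × seq (α +ᴿ fromℕ d) i ℚ.≤ seq (fromℕ n) i ℚ.+ η}
    (_⊗_ {λ i → η ℚ.< seq α i} {λ i → seq (α +ᴿ fromℕ d) i ℚ.≤ seq (fromℕ n) i ℚ.+ η}
      (positive-eventually α 0<α) (≤ᴿ⇒eventually (α +ᴿ fromℕ d) (fromℕ n) α+d≤n η 0<η))
  i : ℕ
  i = proj₁ index
  d<n : d < n
  d<n = conclude (proj₁ (proj₂ index)) (subst₂ (λ p q → p ℚ.≤ q ℚ.+ η)
    (trans (seq-+ α (fromℕ d) i) (cong (λ z → seq α i ℚ.+ z) (seq-fromℕ d i))) (seq-fromℕ n i) (proj₂ (proj₂ index)))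

small-scale : ∀ {η} → 0ℚ ℚ.< η → ∀ K → ∃ λ ε → 0ℚ ℚ.< ε × ε ℚ.≤ 1ℚ × ε ℚ.* ι K ℚ.≤ η
small-scale {η} 0<η K = ε , 0<ε , ε≤1 , εK≤η
  where
  open ℚₚ.≤-Reasoning
  1≤D : 1ℚ ℚ.≤ ι (suc K)
  1≤D = ι-mono-≤ {1} {suc K} (s≤s z≤n)
  0<D : 0ℚ ℚ.< ι (suc K)
  0<D = ℚₚ.<-≤-trans (ℚₚ.positive⁻¹ 1ℚ) 1≤D
  -- The minimum secures both bounds at once; `suc K` keeps the denominator positive when K = 0.
  ε : ℚ
  ε = (η ℚ.⊓ 1ℚ) ℚ.* inv (ι (suc K))
  0<min : 0ℚ ℚ.< η ℚ.⊓ 1ℚ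
  0<min = [ (λ e → subst (0ℚ ℚ.<_) (sym e) 0<η) , (λ e → subst (0ℚ ℚ.<_) (sym e) (ℚₚ.positive⁻¹ 1ℚ)) ]′
    (ℚₚ.⊓-sel η 1ℚ)
  0<ε : 0ℚ ℚ.< ε
  0<ε = 0<* 0<min (inv-pos 0<D)
  0≤ε : 0ℚ ℚ.≤ ε
  0≤ε = ℚₚ.<⇒≤ 0<ε
  εD≡ : ε ℚ.* ι (suc K) ≡ η ℚ.⊓ 1ℚ
  εD≡ = trans (ℚₚ.*-assoc (η ℚ.⊓ 1ℚ) _ _)
    (trans (cong ((η ℚ.⊓ 1ℚ) ℚ.*_) (trans (ℚₚ.*-comm _ (ι (suc K))) (inv-inverse 0<D))) (ℚₚ.*-identityʳ _))
  ε≤1 : ε ℚ.≤ 1ℚ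
  ε≤1 = begin
    ε                    ≡⟨ ℚₚ.*-identityʳ ε ⟨
    ε ℚ.* 1ℚ             ≤⟨ *-monoʳ-≤ 0≤ε 1≤D ⟩
    ε ℚ.* ι (suc K)      ≡⟨ εD≡ ⟩
    η ℚ.⊓ 1ℚ             ≤⟨ ℚₚ.p⊓q≤q η 1ℚ ⟩
    1ℚ                   ∎
  εK≤η : ε ℚ.* ι K ℚ.≤ η
  εK≤η = begin
    ε ℚ.* ι K            ≤⟨ *-monoʳ-≤ 0≤ε (ι-mono-≤ {K} {suc K} (ℕₚ.n≤1+n K)) ⟩
    ε ℚ.* ι (suc K)      ≡⟨ εD≡ ⟩
    η ℚ.⊓ 1ℚ             ≤⟨ ℚₚ.p⊓q≤p η 1ℚ ⟩
    η                    ∎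

-- Since A is at least 1, an additive error is absorbed into the relative error ε A.
close-above : ∀ {x ε A d} → 1 ≤ A → 0ℚ ℚ.≤ ε → x ℚ.+ ι d ℚ.≤ ι (A + d) ℚ.+ ½ ℚ.* ε → x ℚ.≤ (1ℚ ℚ.+ ε) ℚ.* ι A
close-above {x} {ε} {A} {d} 1≤A 0≤ε x≤ = +-cancelʳ-≤ (ι d) (begin
  x ℚ.+ ι d                          ≤⟨ x≤ ⟩
  ι (A + d) ℚ.+ ½ ℚ.* ε              ≤⟨ ℚₚ.+-monoʳ-≤ (ι (A + d)) (ℚₚ.≤-trans ½ε≤ε ε≤εA) ⟩
  ι (A + d) ℚ.+ ε ℚ.* ι A            ≡⟨ cong (λ w → w ℚ.+ ε ℚ.* ι A) (ι-+ A d) ⟩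
  ι A ℚ.+ ι d ℚ.+ ε ℚ.* ι A          ≡⟨ ring (ι A) (ι d) ε ⟩
  (1ℚ ℚ.+ ε) ℚ.* ι A ℚ.+ ι d         ∎)
  where
  open ℚₚ.≤-Reasoning
  ring : ∀ a d e → a ℚ.+ d ℚ.+ e ℚ.* a ≡ (1ℚ ℚ.+ e) ℚ.* a ℚ.+ d
  ring = solve 3 (λ a d e → a :+ d :+ e :* a := (con 1ℚ :+ e) :* a :+ d) refl
  ½≤1 : ½ ℚ.≤ 1ℚ
  ½≤1 = ℚₚ.≤ᵇ⇒≤ _
  ½ε≤ε : ½ ℚ.* ε ℚ.≤ ε
  ½ε≤ε = subst (½ ℚ.* ε ℚ.≤_) (ℚₚ.*-identityˡ ε)
    (ℚₚ.*-monoʳ-≤-nonNeg ε {{ℚ.nonNegative 0≤ε}} ½≤1)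
  ε≤εA : ε ℚ.≤ ε ℚ.* ι A
  ε≤εA = subst (ℚ._≤ ε ℚ.* ι A) (ℚₚ.*-identityʳ ε) (*-monoʳ-≤ 0≤ε (ι-mono-≤ {1} {A} 1≤A))

-- Here the error must be relative to y, about which only y + ε / 2 ≥ 1 is known. With ε at most 1
-- this gives y ≥ 1 / 2, hence ε / 2 ≤ ε y; the factor `½` in the error is there for this.
close-below : ∀ {y ε A d} → 1 ≤ A → 0ℚ ℚ.≤ ε → ε ℚ.≤ 1ℚ →
              ι (A + d) ℚ.≤ y ℚ.+ ℚ.- ι d ℚ.+ ½ ℚ.* ε → ι (A + d + d) ℚ.≤ (1ℚ ℚ.+ ε) ℚ.* y
close-below {y} {ε} {A} {d} 1≤A 0≤ε ε≤1 n≤ = begin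
  ι (A + d + d)                      ≤⟨ B≤ ⟩
  y ℚ.+ ½ ℚ.* ε                      ≡⟨ cong (λ w → y ℚ.+ w) (ℚₚ.*-comm ½ ε) ⟩
  y ℚ.+ ε ℚ.* ½                      ≤⟨ ℚₚ.+-monoʳ-≤ y (*-monoʳ-≤ 0≤ε ½≤y) ⟩
  y ℚ.+ ε ℚ.* y                      ≡⟨ solve 2 (λ y e → y :+ e :* y := (con 1ℚ :+ e) :* y) refl y ε ⟩
  (1ℚ ℚ.+ ε) ℚ.* y                   ∎
  where
  open ℚₚ.≤-Reasoning
  ring : ∀ y d e → y ℚ.+ ℚ.- d ℚ.+ e ℚ.+ d ≡ y ℚ.+ e
  ring = solve 3 (λ y d e → y :- d :+ e :+ d := y :+ e) refl
  B≤ : ι (A + d + d) ℚ.≤ y ℚ.+ ½ ℚ.* ε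
  B≤ = begin
    ι (A + d + d)                          ≡⟨ ι-+ (A + d) d ⟩
    ι (A + d) ℚ.+ ι d                      ≤⟨ ℚₚ.+-monoˡ-≤ (ι d) n≤ ⟩
    y ℚ.+ ℚ.- ι d ℚ.+ ½ ℚ.* ε ℚ.+ ι d      ≡⟨ ring y (ι d) (½ ℚ.* ε) ⟩
    y ℚ.+ ½ ℚ.* ε                          ∎
  ½≤y : ½ ℚ.≤ y
  ½≤y = +-cancelʳ-≤ ½ (begin
    ½ ℚ.+ ½                            ≤⟨ ι-mono-≤ {1} {A + d + d} (ℕₚ.≤-trans 1≤A (ℕₚ.≤-trans (ℕₚ.m≤m+n A d) (ℕₚ.m≤m+n (A + d) d))) ⟩
    ι (A + d + d)                      ≤⟨ B≤ ⟩
    y ℚ.+ ½ ℚ.* ε                      ≤⟨ ℚₚ.+-monoʳ-≤ y (*-monoʳ-≤ (ℚₚ.<⇒≤ (ℚₚ.positive⁻¹ ½)) ε≤1) ⟩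
    y ℚ.+ ½ ℚ.* 1ℚ                     ≡⟨ cong (λ w → y ℚ.+ w) (ℚₚ.*-identityʳ ½) ⟩
    y ℚ.+ ½                            ∎)

seq-monomial : ∀ c x k i → seq (fromℕ c *ᴿ x ^ᴿ k) i ≡ ι c ℚ.* seq x i ^ℚ k
seq-monomial c x k i = cong (ι c ℚ.*_) (seq-^ x k i)

seq-quotient : ∀ x y (0<y : 0ᴿ <ᴿ y) i → seq (x *ᴿ y ⁻¹[ 0<y ]) i ≡ seq x i ℚ.* inv (seq y i)
seq-quotient x y 0<y i = refl

seq-^*sum : ∀ {l} z k (t : Vector ℝ (suc l)) w (s : Vector ℚ (suc l)) j i → seq z i ≡ w →
            (∀ l → seq (t l) i ≡ s l) →
            seq (z ^ᴿ k *ᴿ sumᴿ (removeAt t j)) i ≡ w ^ℚ k ℚ.* sumℚ (removeAt s j)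
seq-^*sum z k t _ s j i refl t≡s = cong₂ ℚ._*_ (seq-^ z k i)
  (trans (seq-sum (removeAt t j) i) (sumℚ-cong _ (removeAt s j) (λ l → t≡s (punchIn j l))))

common-index : ∀ {α β L R x y x′ y′ : ℝ} ((θ , _) : 0ᴿ <ᴿ α) ((ζ , _) : α <ᴿ β) ((η , _) : L <ᴿ R) →
  x ≤ᴿ y → x′ ≤ᴿ y′ → ∀ {τ} → 0ℚ ℚ.< τ →
  ∃ λ i → θ ℚ.< seq α i × seq α i ℚ.+ ζ ℚ.< seq β i × seq L i ℚ.+ η ℚ.< seq R i ×
          seq x i ℚ.≤ seq y i ℚ.+ τ × seq x′ i ℚ.≤ seq y′ i ℚ.+ τ
common-index {α} {β} {L} {R} {x} {y} {x′} {y′} 0<α (_ , _ , α<β) (_ , _ , L<R) x≤y x′≤y′ {τ} 0<τ =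
  pick (positive-eventually α 0<α ⊗ α<β ⊗ L<R ⊗ ≤ᴿ⇒eventually x y x≤y τ 0<τ ⊗ ≤ᴿ⇒eventually x′ y′ x′≤y′ τ 0<τ)

-- N, D, E, L, R stand for n, α + d, β - d and the two sides of the hypothesis.
-- They are variables because unfolding these reals during conversion is very slow.
integral-dominant′ : ∀ {m} (c : Fin (suc m) → ℕ) (j : Fin (suc m)) {A d} → 1 ≤ A →
  (α β N D E L R : ℝ) → 0ᴿ <ᴿ α → α <ᴿ β → L <ᴿ R → N ≤ᴿ E → D ≤ᴿ N →
  (∀ i → seq N i ≡ ι (A + d)) →
  (∀ i → seq D i ≡ seq α i ℚ.+ ι d) →
  (∀ i → seq E i ≡ seq β i ℚ.+ ℚ.- ι d) →
  (∀ i → seq L i ≡ (seq β i ℚ.* inv (seq α i)) ^ℚ (m ∸ toℕ j) ℚ.*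
                   sumℚ (removeAt (λ l → ι (c l) ℚ.* seq α i ^ℚ toℕ l) j)) →
  (∀ i → seq R i ≡ ι (c j) ℚ.* seq α i ^ℚ toℕ j) →
  sum (removeAt (λ i → c i * (A ^ (toℕ i ⊓ toℕ j) * (A + d + d) ^ (toℕ i ∸ toℕ j))) j) < c j * A ^ toℕ j
integral-dominant′ {m} c j {A} {d} 1≤A α β N D E L R 0<α@(θ , 0<θ , _) α<β@(ζ , 0<ζ , _) L<R@(η , 0<η , _)
  N≤E D≤N N≡ D≡ E≡ L≡ R≡ = at-scale (small-scale 0<η (2 ^ m * (c j * (2 * A) ^ toℕ j)))
  where
  Goal : Set
  Goal = sum (removeAt (λ i → c i * (A ^ (toℕ i ⊓ toℕ j) * (A + d + d) ^ (toℕ i ∸ toℕ j))) j) < c j * A ^ toℕ j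
  at-index : ∀ {ε} → 0ℚ ℚ.< ε → ε ℚ.≤ 1ℚ → ε ℚ.* ι (2 ^ m * (c j * (2 * A) ^ toℕ j)) ℚ.≤ η →
    (∃ λ i → θ ℚ.< seq α i × seq α i ℚ.+ ζ ℚ.< seq β i × seq L i ℚ.+ η ℚ.< seq R i ×
             seq N i ℚ.≤ seq E i ℚ.+ ½ ℚ.* ε × seq D i ℚ.≤ seq N i ℚ.+ ½ ℚ.* ε) → Goal
  at-index {ε} 0<ε ε≤1 εK≤η (i , θ<x , x<y , dom , N≤ , D≤) =
    rational-dominant c j (ℚₚ.<-trans 0<θ θ<x)
      (ℚₚ.<⇒≤ (ℚₚ.≤-<-trans (p≤p+q (seq α i) (ℚₚ.<⇒≤ 0<ζ)) x<y)) 1≤A (ℚₚ.<⇒≤ 0<η) (ℚₚ.<⇒≤ 0<ε) ε≤1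
      (close-above {d = d} 1≤A (ℚₚ.<⇒≤ 0<ε) (subst₂ (λ p q → p ℚ.≤ q ℚ.+ ½ ℚ.* ε) (D≡ i) (N≡ i) D≤))
      (close-below {A = A} {d} 1≤A (ℚₚ.<⇒≤ 0<ε) ε≤1 (subst₂ (λ p q → p ℚ.≤ q ℚ.+ ½ ℚ.* ε) (N≡ i) (E≡ i) N≤))
      εK≤η (subst₂ (λ p q → p ℚ.+ η ℚ.< q) (L≡ i) (R≡ i) dom)
  at-scale : (∃ λ ε → 0ℚ ℚ.< ε × ε ℚ.≤ 1ℚ × ε ℚ.* ι (2 ^ m * (c j * (2 * A) ^ toℕ j)) ℚ.≤ η) → Goal
  at-scale (ε , 0<ε , ε≤1 , εK≤η) = at-index 0<ε ε≤1 εK≤η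
    (common-index {α} {β} {L} {R} {N} {E} {D} {N} 0<α α<β L<R N≤E D≤N (0<* (ℚₚ.positive⁻¹ ½) 0<ε))

-- Lets t be inferred: repeating the λ-term of the hypothesis on dominance as an
-- argument would make Agda compare the Cauchy moduli of both copies.
record Monomials {m} (c : Fin (suc m) → ℕ) (x : ℝ) (t : Fin (suc m) → ℝ) : Set where
  field
    seq-term : ∀ l i → seq (t l) i ≡ ι (c l) ℚ.* seq x i ^ℚ toℕ l

monomials : ∀ {m} (a : Vec ℤ (suc m)) x →
            Monomials (λ l → ∣ lookup a l ∣) x (λ l → fromℕ ∣ lookup a l ∣ *ᴿ x ^ᴿ toℕ l)
monomials a x = record { seq-term = λ l i → seq-monomial ∣ lookup a l ∣ x (toℕ l) i }

integral-dominant : ∀ {m} {c : Fin (suc m) → ℕ} {α t} → Monomials c α t →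
  ∀ β (0<α : 0ᴿ <ᴿ α) → α <ᴿ β → (j : Fin (suc m)) →
  (β *ᴿ α ⁻¹[ 0<α ]) ^ᴿ (m ∸ toℕ j) *ᴿ sumᴿ (removeAt t j) <ᴿ t j →
  ∀ {N A d} → N ≡ A + d → 1 ≤ A → fromℕ N ≤ᴿ β -ᴿ fromℕ d → α +ᴿ fromℕ d ≤ᴿ fromℕ N →
  sum (removeAt (λ i → c i * (A ^ (toℕ i ⊓ toℕ j) * (A + d + d) ^ (toℕ i ∸ toℕ j))) j) < c j * A ^ toℕ j
integral-dominant {m} {c} {α} {t} mono β 0<α α<β j dom {_} {A} {d} refl 1≤A n≤β-d α+d≤n =
  integral-dominant′ c j 1≤A α β (fromℕ (A + d)) (α +ᴿ fromℕ d) (β -ᴿ fromℕ d)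
    ((β *ᴿ α ⁻¹[ 0<α ]) ^ᴿ (m ∸ toℕ j) *ᴿ sumᴿ (removeAt t j)) (t j) 0<α α<β dom n≤β-d α+d≤n
    (seq-fromℕ (A + d)) (λ i → refl) (λ i → refl)
    (λ i → seq-^*sum (β *ᴿ α ⁻¹[ 0<α ]) (m ∸ toℕ j) t (seq β i ℚ.* inv (seq α i))
      (λ l → ι (c l) ℚ.* seq α i ^ℚ toℕ l) j i (seq-quotient β α 0<α i) (λ l → seq-term l i))
    (seq-term j)
  where open Monomials mono

-- Factors of f and irreducibility

taylor-vanishes : ∀ g n i → length g ≤ i → taylor g n i ≡ 0ℤ
taylor-vanishes []      n i       _         = refl
taylor-vanishes (a ∷ g) n (suc i) (s≤s g≤i) = trans
  (cong₂ (λ x y → a ℤ.* 0ℤ ℤ.+ (n ℤ.* x ℤ.+ 1ℤ ℤ.* y))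
    (taylor-vanishes g n (suc i) (ℕₚ.m≤n⇒m≤1+n g≤i)) (taylor-vanishes g n i g≤i))
  (ring a n)
  where
  ring : ∀ a n → a ℤ.* 0ℤ ℤ.+ (n ℤ.* 0ℤ ℤ.+ 1ℤ ℤ.* 0ℤ) ≡ 0ℤ
  ring = solve-∀

constant-or-degree : ∀ g → (∀ i → coeff g (suc i) ≡ 0ℤ) ⊎ ∃ λ r → HasDegree g (suc r)
constant-or-degree [] = inj₁ λ _ → refl
constant-or-degree (a ∷ g) with degree g
... | inj₁ g≈0                = inj₁ g≈0
... | inj₂ (r , gᵣ≢0 , above) = inj₂ (r , gᵣ≢0 , λ { (suc i) (s≤s r<i) → above i r<i })

module _ (g : Poly) (constant : ∀ i → coeff g (suc i) ≡ 0ℤ) where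

  coeff-constant-* : ∀ h i → coeff (g *ₚ h) i ≡ coeff g 0 ℤ.* coeff h i
  coeff-constant-* h i = begin
    coeff (g *ₚ h) i                                      ≡⟨ coeff-act (g *ₚ h) i ⟩
    act 0ℤ 1ℤ (g *ₚ h) δ i                                ≡⟨ act-*ₚ 0ℤ 1ℤ g h δ i ⟩
    act 0ℤ 1ℤ g (act 0ℤ 1ℤ h δ) i                         ≡⟨ act-≈ 0ℤ 1ℤ g (coeff g 0 ∷ []) (act 0ℤ 1ℤ h δ) g≈c i ⟩
    coeff g 0 ℤ.* act 0ℤ 1ℤ h δ i ℤ.+ op 0ℤ 1ℤ (λ _ → 0ℤ) i
      ≡⟨ cong₂ (λ x y → coeff g 0 ℤ.* x ℤ.+ y) (sym (coeff-act h i)) (op-0 0ℤ 1ℤ (λ _ → refl) i) ⟩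
    coeff g 0 ℤ.* coeff h i ℤ.+ 0ℤ                        ≡⟨ ℤₚ.+-identityʳ _ ⟩
    coeff g 0 ℤ.* coeff h i                               ∎
    where
    open ≡-Reasoning
    g≈c : g ≈ₚ coeff g 0 ∷ []
    g≈c zero    = refl
    g≈c (suc i) = constant i

  -- A unit of ℤ is its own inverse, so the constant itself serves as the quotient.
  constant-unit : ∣ coeff g 0 ∣ ≡ 1 → g ∣ₚ (1ℤ ∷ [])
  constant-unit ∣c∣≡1 = record { quotient = coeff g 0 ∷ [] ; equality = λ i → trans
    (*ₚ-comm (coeff g 0 ∷ []) g i) (trans (coeff-constant-* (coeff g 0 ∷ []) i) (square i)) }
    where
    c*c≡1 : ∀ c → ∣ c ∣ ≡ 1 → c ℤ.* c ≡ 1ℤ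
    c*c≡1 (+ 1)      refl = refl
    c*c≡1 (-[1+ 0 ]) refl = refl
    square : ∀ i → coeff g 0 ℤ.* coeff (coeff g 0 ∷ []) i ≡ coeff (1ℤ ∷ []) i
    square zero    = c*c≡1 (coeff g 0) ∣c∣≡1
    square (suc i) = ℤₚ.*-zeroʳ (coeff g 0)

∣coeffs⇒∣content : ∀ c f → (∀ i → c ∣ coeff f i) → c ∣ foldr ℤ.gcd 0ℤ f
∣coeffs⇒∣content c []      _   = ∣ c ∣ ℕ∣.∣0
∣coeffs⇒∣content c (a ∷ f) c∣f = ℤ.gcd-greatest {a} {foldr ℤ.gcd 0ℤ f} {c} (c∣f 0)
  (∣coeffs⇒∣content c f (λ i → c∣f (suc i)))

-- A constant factor divides every coefficient of `f`, hence its content.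
constant-factor-unit : ∀ f g h → Primitive f → f ≈ₚ g *ₚ h → (∀ i → coeff g (suc i) ≡ 0ℤ) → g ∣ₚ (1ℤ ∷ [])
constant-factor-unit f g h content≡1 f≈gh constant = constant-unit g constant (ℕ∣.∣1⇒≡1
  (subst (coeff g 0 ∣_) content≡1 (∣coeffs⇒∣content (coeff g 0) f λ i →
    subst (λ x → ∣ coeff g 0 ∣ ∣ℕ ∣ x ∣) (sym (trans (f≈gh i) (coeff-constant-* g constant h i)))
      (subst (∣ coeff g 0 ∣ ∣ℕ_) (sym (ℤₚ.abs-* (coeff g 0) (coeff h i))) (ℕ∣.m∣m*n ∣ coeff h i ∣)))))

-- A factor of pᵏ d that is prime to p divides d.
large-factors : ∀ {p k d b c} → Prime p → p ∤ℕ d → b * c ≡ p ^ k * d → d < b → d < c →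
  ∃₂ λ u w → ∃₂ λ x y → b ≡ p ^ u * x × p ∤ℕ x × c ≡ p ^ w * y × p ∤ℕ y × u + w ≡ k × 1 ≤ u × 1 ≤ w
large-factors {p} {k} {d} {b} {c} p-prime p∤d bc≡ d<b d<c = conclude
  (valuation p-prime (suc k) (λ p∣b → too-big (ℕ∣.∣m⇒∣m*n c p∣b)))
  (valuation p-prime (suc k) (λ p∣c → too-big (ℕ∣.∣n⇒∣m*n b p∣c)))
  where
  open ≡-Reasoning
  instance
    pᵏ≢0 : ℕ.NonZero (p ^ k)
    pᵏ≢0 = ℕₚ.m^n≢0 p k {{prime⇒nonZero p-prime}}
    d≢0 : ℕ.NonZero d
    d≢0 = ℕ.≢-nonZero λ { refl → p∤d (p ℕ∣.∣0) }
  too-big : ¬ (p ^ suc k ∣ℕ b * c)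
  too-big p∣bc = ℕₚ.1+n≰n (^∣^*⇒≤ p-prime {suc k} {k} p∤d (subst (p ^ suc k ∣ℕ_) bc≡ p∣bc))
  -- With exponent 0 the factor would be its own p-free part, a divisor of d, and could not exceed
  -- d.
  positive : ∀ {b u x} → d < b → b ≡ p ^ u * x → x ∣ℕ d → 1 ≤ u
  positive {u = zero}  {x} d<b refl x∣d =
    contradiction (ℕ∣.∣⇒≤ x∣d) (ℕₚ.<⇒≱ (subst (d <_) (ℕₚ.*-identityˡ x) d<b))
  positive {u = suc u}     _   _    _   = s≤s z≤n
  conclude : (∃₂ λ u x → b ≡ p ^ u * x × p ∤ℕ x) → (∃₂ λ w y → c ≡ p ^ w * y × p ∤ℕ y) →
    ∃₂ λ u w → ∃₂ λ x y → b ≡ p ^ u * x × p ∤ℕ x × c ≡ p ^ w * y × p ∤ℕ y × u + w ≡ k × 1 ≤ u × 1 ≤ w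
  conclude (u , x , b≡ , p∤x) (w , y , c≡ , p∤y) = u , w , x , y , b≡ , p∤x , c≡ , p∤y , u+w≡k
    , positive d<b b≡ (ℕ∣.divides y (trans (sym xy≡d) (ℕₚ.*-comm x y)))
    , positive d<c c≡ (ℕ∣.divides x (sym xy≡d))
    where
    swap : ∀ a x b y → a * b * (x * y) ≡ a * x * (b * y)
    swap = ℕ-Solver.solve-∀
    product : p ^ (u + w) * (x * y) ≡ p ^ k * d
    product = begin
      p ^ (u + w) * (x * y)        ≡⟨ cong (_* (x * y)) (ℕₚ.^-distribˡ-+-* p u w) ⟩
      p ^ u * p ^ w * (x * y)      ≡⟨ swap (p ^ u) x (p ^ w) y ⟩
      p ^ u * x * (p ^ w * y)      ≡⟨ cong₂ _*_ b≡ c≡ ⟨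
      b * c                        ≡⟨ bc≡ ⟩
      p ^ k * d                    ∎
    u+w≡k : u + w ≡ k
    u+w≡k = valuation-unique p-prime (∤-* p-prime p∤x p∤y) p∤d product
    xy≡d : x * y ≡ d
    xy≡d = ℕₚ.*-cancelˡ-≡ (x * y) d (p ^ k) (subst (λ e → p ^ e * (x * y) ≡ p ^ k * d) u+w≡k product)

module _ {m N A d : ℕ} (N≡A+d : N ≡ A + d) (a : Vec ℤ (suc m)) (content≡1 : Primitive (toList a)) (j : Fin (suc m)) (1≤A : 1 ≤ A)
  {k ℓ p : ℕ}
  (dominant : sum (removeAt (λ i → ∣ lookup a i ∣ * (A ^ (toℕ i ⊓ toℕ j) * (A + d + d) ^ (toℕ i ∸ toℕ j))) j)
              < ∣ lookup a j ∣ * A ^ toℕ j)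
  (1≤k : 1 ≤ k) (1≤ℓ : 1 ≤ ℓ) (p-prime : Prime p) (p∤d : p ∤ℕ d)
  (∣f[n]∣≡ : ∣ eval (toList a) (+ N) ∣ ≡ p ^ k * d) (coprime : gcd k ℓ ≡ 1)
  (low : ∀ i → i < ℓ → + (p ^ k) ∣ dividedDerivative (toList a) i (+ N))
  (unit : 1 < k → ¬ (+ p ∣ dividedDerivative (toList a) ℓ (+ N)))
  where

  private
    f : Poly
    f = toList a
    n : ℤ
    n = + N

  p∣f[n] : p ∣ℕ ∣ eval f n ∣
  p∣f[n] = subst (p ∣ℕ_) (sym ∣f[n]∣≡) (ℕ∣.∣m⇒∣m*n d (subst (_∣ℕ p ^ k) (ℕₚ.^-identityʳ p) (^-∣ p 1≤k)))

  f[n]≢0 : eval f n ≢ 0ℤ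
  f[n]≢0 f[n]≡0 = [ ℕ.≢-nonZero⁻¹ (p ^ k) {{ℕₚ.m^n≢0 p k {{prime⇒nonZero p-prime}}}}
                  , (λ { refl → p∤d (p ℕ∣.∣0) }) ]′
    (ℕₚ.m*n≡0⇒m≡0∨n≡0 (p ^ k) (trans (sym ∣f[n]∣≡) (cong ∣_∣ f[n]≡0)))

  -- A unit takes the values 1 and -1 only, whereas p divides `f (n)`.
  f-nonunit : ¬ (f ∣ₚ (1ℤ ∷ []))
  f-nonunit record { quotient = q ; equality = qf≈1 } = ℕ.nonTrivial⇒≢1 {{prime⇒nonTrivial p-prime}}
    (ℕ∣.∣1⇒≡1 (subst (p ∣ℕ_) ∣f[n]∣≡1 p∣f[n]))
    where
    ∣f[n]∣≡1 : ∣ eval f n ∣ ≡ 1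
    ∣f[n]∣≡1 = ℕₚ.m*n≡1⇒n≡1 ∣ eval q n ∣ ∣ eval f n ∣ (trans (sym (ℤₚ.abs-* (eval q n) (eval f n)))
      (cong ∣_∣ (trans (sym (eval-*ₚ (1ℤ ∷ []) q f n (λ i → sym (qf≈1 i))))
        (cong (λ x → 1ℤ ℤ.+ x) (ℤₚ.*-zeroʳ n)))))

  nonconstant-large : ∀ {r} g h → f ≈ₚ g *ₚ h → HasDegree g (suc r) → d < ∣ eval g n ∣
  nonconstant-large g h f≈gh deg-g = subst (λ n → d < ∣ eval g (+ n) ∣) (sym N≡A+d)
    (factor-large a j 1≤A dominant g h f≈gh g[n]≢0 deg-g)
    where
    g[n]≢0 : eval g (+ (A + d)) ≢ 0ℤ
    g[n]≢0 g[n]≡0 = f[n]≢0 (trans (eval-*ₚ f g h n f≈gh)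
      (cong (ℤ._* eval h n) (trans (cong (λ n → eval g (+ n)) N≡A+d) g[n]≡0)))

  no-proper-factors : ∀ {r s} g h → f ≈ₚ g *ₚ h → HasDegree g (suc r) → HasDegree h (suc s) → ⊥
  no-proper-factors g h f≈gh deg-g deg-h = conclude (large-factors {p} {k} {d} p-prime p∤d
    (trans (sym (ℤₚ.abs-* (eval g n) (eval h n))) (trans (cong ∣_∣ (sym (eval-*ₚ f g h n f≈gh))) ∣f[n]∣≡))
    (nonconstant-large g h f≈gh deg-g)
    (nonconstant-large h g (λ i → trans (f≈gh i) (*ₚ-comm g h i)) deg-h))
    where
    derivative≡ : ∀ i → dividedDerivative f i n ≡ (taylor g n ⋆ taylor h n) i
    derivative≡ i = trans (dividedDerivative≡taylor f i n) (taylor-*ₚ f g h n f≈gh i)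
    conclude : (∃₂ λ u w → ∃₂ λ x y → ∣ eval g n ∣ ≡ p ^ u * x × p ∤ℕ x × ∣ eval h n ∣ ≡ p ^ w * y × p ∤ℕ y ×
                u + w ≡ k × 1 ≤ u × 1 ≤ w) → ⊥
    conclude (u , w , x , y , g≡ , p∤x , h≡ , p∤y , u+w≡k , 1≤u , 1≤w) =
      newton p-prime coprime 1≤ℓ {taylor g n} {taylor h n} (taylor-vanishes g n) (taylor-vanishes h n)
        (λ i i<ℓ → subst (λ t → p ^ k ∣ℕ ∣ t ∣) (derivative≡ i) (low i i<ℓ))
        -- Both exponents are at least 1, so k = u + w is at least 2 and the condition at ℓ applies.
        -- For k = 1 the contradiction is already contained in 1 ≤ u and 1 ≤ w.
        (λ p∣ → unit (subst (1 <_) u+w≡k (ℕₚ.+-mono-≤ 1≤u 1≤w))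
          (subst (λ t → p ∣ℕ ∣ t ∣) (sym (derivative≡ ℓ)) p∣))
        (trans (cong ∣_∣ (sym (eval-act n 1ℤ g))) g≡) p∤x
        (trans (cong ∣_∣ (sym (eval-act n 1ℤ h))) h≡) p∤y u+w≡k 1≤u 1≤w

  irreducible : Irreducible f
  irreducible = record { p∤1 = f-nonunit ; split-∣1 = λ {g} {h} → split g h }
    where
    split : ∀ g h → f ≈ₚ g *ₚ h → g ∣ₚ (1ℤ ∷ []) ⊎ h ∣ₚ (1ℤ ∷ [])
    split g h f≈gh with constant-or-degree g | constant-or-degree h
    ... | inj₁ const-g     | _                = inj₁ (constant-factor-unit f g h content≡1 f≈gh const-g)
    ... | inj₂ _           | inj₁ const-h     = inj₂ (constant-factor-unit f h g content≡1
            (λ i → trans (f≈gh i) (*ₚ-comm g h i)) const-h)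
    ... | inj₂ (_ , deg-g) | inj₂ (_ , deg-h) = contradiction (no-proper-factors g h f≈gh deg-g deg-h) λ ()

theorem3 :
  (m : ℕ) (a : Vec ℤ (suc m)) →
  let f : Poly
      f = toList a
      term : ℝ → Fin (suc m) → ℝ
      term x i = fromℕ ∣ lookup a i ∣ *ᴿ x ^ᴿ toℕ i
  in
  Primitive f →
  (α β : ℝ) (0<α : 0ᴿ <ᴿ α) → 0ᴿ <ᴿ β → α <ᴿ β →
  (j : Fin (suc m)) →
  (β *ᴿ α ⁻¹[ 0<α ]) ^ᴿ (m ∸ toℕ j) *ᴿ sumᴿ (removeAt (term α) j) <ᴿ term α j →
  (n d k ℓ p : ℕ) →
  1 ≤ n → 1 ≤ d → 1 ≤ k → 1 ≤ ℓ → ℓ ≤ m →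
  Prime p → p ∤ℕ d →
  fromℕ n ≤ᴿ β -ᴿ fromℕ d → α +ᴿ fromℕ d ≤ᴿ fromℕ n →
  (eval f (+ n) ≡ + (p ^ k * d)) ⊎ (eval f (+ n) ≡ - (+ (p ^ k * d))) →
  gcd k ℓ ≡ 1 →
  (∀ i → i < ℓ → + (p ^ k) ∣ dividedDerivative f i (+ n)) →
  (1 < k → ¬ (+ p ∣ dividedDerivative f ℓ (+ n))) →
  Irreducible f
theorem3 m a content≡1 α β 0<α _ α<β j dominant n d k ℓ p _ _ 1≤k 1≤ℓ _ p-prime p∤d n≤β-d α+d≤n f[n]≡ coprime low unit =
  conclude (below-gap α 0<α α+d≤n)
  where
  conclude : (∃ λ A → n ≡ A + d × 1 ≤ A) → Irreducible (toList a)
  conclude (A , n≡A+d , 1≤A) = irreducible n≡A+d a content≡1 j 1≤A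
    (integral-dominant (monomials a α) β 0<α α<β j dominant n≡A+d 1≤A n≤β-d α+d≤n) 1≤k 1≤ℓ p-prime p∤d
    ([ cong ∣_∣ , (λ e → trans (cong ∣_∣ e) (ℤₚ.∣-i∣≡∣i∣ (+ (p ^ k * d)))) ]′ f[n]≡) coprime low unit
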